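{- If $b = 5m \cdot 2^n$ for some odd integer $m > 1$ and some integer $n \ge 0$, then $$C_b = \frac{|S_b|}{b^4} = \frac{8 + 40 \cdot 4^n}{5 \cdot b^2} = \frac{8}{5 \cdot b^2} + \frac{8}{25 m^2}.$$
   Context: Let $b \ge 2$ be an integer. A four-digit base-$b$ number is an integer $x$ with $0 \le x < b^4$, written with exactly four base-$b$ digits (leading zeros allowed). The Kaprekar function $K_b$ maps such an $x$ to $K_b(x) = D - A$, where $D$ is the integer whose four base-$b$ digits are the digits of $x$ (with multiplicity, including leading zeros) arranged in descending order, and $A$ is the integer whose digits are the same digits arranged in ascending order. The result is again regarded as a four-digit base-$b$ number. $S_b$ is the set of four-digit base-$b$ numbers $x$ for which the sequence of iterates $K_b^t(x)$ is eventually a non-zero constant as $t$ increases. (When $5 \mid b$, it is known that $K_b$ has exactly one non-zero four-digit fixed point, so $S_b$ is the set of inputs which eventually reach it.) $C_b = |S_b|/b^4$ is the fraction of all four-digit inputs which lie in $S_b$. -}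

module Defs where

open import Data.Digit using (Digit; fromDigits)
open import Data.Fin.Base using (Fin; toℕ; fromℕ<; finToFun; funToFin)
open import Data.Fin.Properties as Fin
  using (toℕ<n; pigeonhole; toℕ-combine; funToFin-finToFin)
open import Data.Fin.Subset using (Subset; ∣_∣)
import Data.Integer.Base as ℤ
open import Data.List.Base using (List; []; _∷_; length; reverse; tabulate)
open import Data.List.Properties using (length-tabulate)
import Data.List.Sort.Base as SortBase
import Data.List.Sort.InsertionSort as InsertionSort
open import Data.List.Relation.Binary.Permutation.Propositional.Properties
  using (↭-length)
open import Data.Nat.Base
open import Data.Nat.GeneralisedArithmetic using (iterate)
open import Data.Nat.Properties
open import Data.Nat.Tactic.RingSolver using (solve-∀)
open import Data.Product.Base using (∃-syntax; _×_; _,_)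
open import Data.Rational.Base as ℚ using (ℚ)
import Data.Vec.Base as Vec
open import Relation.Binary.PropositionalEquality
open import Relation.Nullary.Decidable using (Dec; does; map′; ¬?; _×-dec_)

FourDigit : ℕ → Set
FourDigit b = Fin (b ^ 4)

digits : ∀ b → FourDigit b → List (Digit b)
digits b x = tabulate (finToFun {b} {4} x)

-- The list returned by `digits` starts with the most significant digit,
-- whereas `fromDigits` reads the least significant digit first.
fromDigits-digits : ∀ b (x : FourDigit b) →
                    fromDigits (reverse (digits b x)) ≡ toℕ x
fromDigits-digits b x = begin
  fromDigits (reverse (tabulate f))  ≡⟨ shape b (toℕ (f 0F)) (toℕ (f 1F)) (toℕ (f 2F)) (toℕ (f 3F)) ⟩
  b ^ 3 * toℕ (f 0F) + (b ^ 2 * toℕ (f 1F) +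
    (b ^ 1 * toℕ (f 2F) + (b ^ 0 * toℕ (f 3F) + 0)))  ≡⟨ value f ⟨
  toℕ (funToFin f)                   ≡⟨ cong toℕ (funToFin-finToFin {4} {b} x) ⟩
  toℕ x                              ∎
  where
  open ≡-Reasoning
  open import Data.Fin.Patterns using (0F; 1F; 2F; 3F)

  f : Fin 4 → Fin b
  f = finToFun {b} {4} x

  shape : ∀ b p q r s →
          s + (r + (q + (p + 0 * b) * b) * b) * b ≡
          b * (b * (b * 1)) * p + (b * (b * 1) * q + (b * 1 * r + (1 * s + 0)))
  shape = solve-∀

  value : (g : Fin 4 → Fin b) →
          toℕ (funToFin g) ≡
          b ^ 3 * toℕ (g 0F) + (b ^ 2 * toℕ (g 1F) +
            (b ^ 1 * toℕ (g 2F) + (b ^ 0 * toℕ (g 3F) + 0)))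
  value g =
    trans (toℕ-combine (g 0F) _) (cong (λ v → b ^ 3 * toℕ (g 0F) + v)
    (trans (toℕ-combine (g 1F) _) (cong (λ v → b ^ 2 * toℕ (g 1F) + v)
    (trans (toℕ-combine (g 2F) _) (cong (λ v → b ^ 1 * toℕ (g 2F) + v)
    (toℕ-combine {n = b ^ 0} (g 3F) 0F))))))

module _ (b : ℕ) where

  open InsertionSort (Fin.≤-decTotalOrder b) using (sort; insertionSort)
  open SortBase (Fin.≤-totalOrder b) using (module SortingAlgorithm)

  -- `sort` is increasing and `fromDigits` reads the least significant
  -- digit first, so `descending x` has its largest digit in front.
  descending : FourDigit b → ℕ
  descending x = fromDigits (sort (digits b x))

  ascending : FourDigit b → ℕ
  ascending x = fromDigits (reverse (sort (digits b x)))

  fromDigits< : (ds : List (Digit b)) → fromDigits ds < b ^ length ds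
  fromDigits< []       = s≤s z≤n
  fromDigits< (d ∷ ds) = begin-strict
    toℕ d + fromDigits ds * b  <⟨ +-monoˡ-< (fromDigits ds * b) (toℕ<n d) ⟩
    suc (fromDigits ds) * b    ≤⟨ *-monoˡ-≤ b (fromDigits< ds) ⟩
    b ^ length ds * b          ≡⟨ *-comm (b ^ length ds) b ⟩
    b * b ^ length ds          ∎
    where open ≤-Reasoning

  descending<b⁴ : (x : FourDigit b) → descending x < b ^ 4
  descending<b⁴ x = subst (λ l → descending x < b ^ l)
    (trans (↭-length (SortingAlgorithm.sort-↭ insertionSort (digits b x)))
           (length-tabulate (finToFun {b} {4} x)))
    (fromDigits< (sort (digits b x)))

-- Since ascending x ≤ descending x, the subtraction is never truncated.
K : ∀ b → FourDigit b → FourDigit b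
K b x = fromℕ< {descending b x ∸ ascending b x}
          (≤-<-trans (m∸n≤m (descending b x) (ascending b x)) (descending<b⁴ b x))

EventuallyNonzeroConstant : ∀ b → FourDigit b → Set
EventuallyNonzeroConstant b x =
  ∃[ c ] (toℕ c ≢ 0 × ∃[ T ] (∀ t → T ≤ t → iterate (K b) x t ≡ c))

module Iterates {N : ℕ} (f : Fin N → Fin N) where

  iterate-+ : ∀ x m n → iterate f x (m + n) ≡ iterate f (iterate f x m) n
  iterate-+ x zero    n = refl
  iterate-+ x (suc m) n = iterate-+ (f x) m n

  iterate-fix : ∀ {c} → f c ≡ c → ∀ n → iterate f c n ≡ c
  iterate-fix fc≡c zero    = refl
  iterate-fix fc≡c (suc n) =
    trans (cong (λ y → iterate f y n) fc≡c) (iterate-fix fc≡c n)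

  iterate-* : ∀ y p → iterate f y p ≡ y → ∀ k → iterate f y (k * p) ≡ y
  iterate-* y p per zero    = refl
  iterate-* y p per (suc k) = begin
    iterate f y (p + k * p)              ≡⟨ iterate-+ y p (k * p) ⟩
    iterate f (iterate f y p) (k * p)    ≡⟨ cong (λ z → iterate f z (k * p)) per ⟩
    iterate f y (k * p)                  ≡⟨ iterate-* y p per k ⟩
    y                                    ∎
    where open ≡-Reasoning

  limit-fixed : ∀ x c T → (∀ t → T ≤ t → iterate f x t ≡ c) → f c ≡ c
  limit-fixed x c T lim = begin
    f c                          ≡⟨ cong f (lim T ≤-refl) ⟨
    iterate f (iterate f x T) 1  ≡⟨ iterate-+ x T 1 ⟨
    iterate f x (T + 1)          ≡⟨ lim (T + 1) (m≤m+n T 1) ⟩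
    c                            ∎
    where open ≡-Reasoning

  limit-reached : ∀ x c T → (∀ t → T ≤ t → iterate f x t ≡ c) →
                  iterate f x N ≡ c
  limit-reached x c T lim
    with i , j , i<j , eq ← pigeonhole (n<1+n N) (λ k → iterate f x (toℕ k)) = begin
      iterate f x N                                  ≡⟨ cong (iterate f x) (m+[n∸m]≡n i≤N) ⟨
      iterate f x (toℕ i + (N ∸ toℕ i))              ≡⟨ iterate-+ x (toℕ i) _ ⟩
      iterate f (iterate f x (toℕ i)) (N ∸ toℕ i)    ≡⟨ cong (λ y → iterate f y (N ∸ toℕ i)) at-i ⟩
      iterate f c (N ∸ toℕ i)                        ≡⟨ iterate-fix (limit-fixed x c T lim) (N ∸ toℕ i) ⟩
      c                                              ∎
    where
    open ≡-Reasoning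
    i≤N : toℕ i ≤ N
    i≤N = s≤s⁻¹ (toℕ<n i)
    p : ℕ
    p = toℕ j ∸ toℕ i
    y : Fin N
    y = iterate f x (toℕ i)
    period : iterate f y p ≡ y
    period = begin
      iterate f y p              ≡⟨ iterate-+ x (toℕ i) p ⟨
      iterate f x (toℕ i + p)    ≡⟨ cong (iterate f x) (m+[n∸m]≡n (<⇒≤ i<j)) ⟩
      iterate f x (toℕ j)        ≡⟨ eq ⟨
      y                          ∎
    late : T ≤ toℕ i + T * p
    late = ≤-trans (m≤m*n T p {{>-nonZero (m<n⇒0<n∸m i<j)}}) (m≤n+m (T * p) (toℕ i))
    at-i : y ≡ c
    at-i = begin
      y                              ≡⟨ iterate-* y p period T ⟨
      iterate f y (T * p)            ≡⟨ iterate-+ x (toℕ i) (T * p) ⟨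
      iterate f x (toℕ i + T * p)    ≡⟨ lim (toℕ i + T * p) late ⟩
      c                              ∎

-- There are only b⁴ states, so a sequence of iterates which is eventually
-- constant is already constant from index b⁴ on.
eventuallyNonzeroConstant? : ∀ b (x : FourDigit b) →
                             Dec (EventuallyNonzeroConstant b x)
eventuallyNonzeroConstant? b x = map′ to from
  (¬? (toℕ z ≟ 0) ×-dec (K b z Fin.≟ z))
  where
  open Iterates (K b)
  N = b ^ 4
  z = iterate (K b) x N

  to : toℕ z ≢ 0 × K b z ≡ z → EventuallyNonzeroConstant b x
  to (z≢0 , fix) = z , z≢0 , N , λ t N≤t →
    trans (cong (iterate (K b) x) (sym (m+[n∸m]≡n N≤t)))
    (trans (iterate-+ x N (t ∸ N)) (iterate-fix fix (t ∸ N)))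

  from : EventuallyNonzeroConstant b x → toℕ z ≢ 0 × K b z ≡ z
  from (c , c≢0 , T , lim) =
    subst (λ w → toℕ w ≢ 0 × K b w ≡ w) (sym (limit-reached x c T lim))
          (c≢0 , limit-fixed x c T lim)

S : ∀ b → Subset (b ^ 4)
S b = Vec.tabulate (λ x → does (eventuallyNonzeroConstant? b x))

module _ (b : ℕ) .{{_ : NonTrivial b}} where

  private instance
    b≢0 : NonZero b
    b≢0 = nonTrivial⇒nonZero b

  b^k≢0 : ∀ k → NonZero (b ^ k)
  b^k≢0 k = m^n≢0 b k

  a*b²≢0 : ∀ a → .{{NonZero a}} → NonZero (a * b ^ 2)
  a*b²≢0 a = m*n≢0 a (b ^ 2) {{it}} {{b^k≢0 2}}
    where open import Function.Base using (it)

C : ∀ b → .{{NonTrivial b}} → ℚ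
C b = (ℤ.+ ∣ S b ∣ ℚ./ (b ^ 4)) {{b^k≢0 b 4}}

{-# OPTIONS --safe #-}

-- Let D = (largest − smallest digit) and E = (difference of the middle digits).
-- Then K(x) = D (b³ − 1) + E (b² − b) depends only on (D , E), and for E > 0 its
-- own pair is {|2D − b| , |2E − b|} in decreasing order, except when these two
-- numbers coincide. The unique non-zero fixed pair is (3b/5 , b/5). Since m > 1 is
-- odd, pulling it back never meets the exceptional cases, and the pairs flowing
-- into it are exactly (m i , m j) with i² + j² ≡ 0 ≢ i² (mod 5): folding is
-- multiplication by ±2 modulo 5, and each step makes i and j more divisible by 2.
-- A pair 0 < E < D belongs to 24 (b − D) (D − E) inputs, and the resulting
-- weighted sum over the residue classes is a polynomial in m and 2ⁿ.

module Submission where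

open import Defs
import Algebra.Properties.Semiring.Sum
open import Data.Bool.Base using (Bool; true; false; if_then_else_; not)
open import Data.Digit using (fromDigits)
open import Data.Empty using (⊥; ⊥-elim)
open import Data.Fin.Base using (Fin; zero; suc; toℕ; fromℕ<; funToFin; combine; _↑ˡ_; _↑ʳ_)
open import Data.Fin.Patterns
open import Data.Fin.Properties as Fin using (toℕ<n; toℕ-fromℕ<; toℕ-injective; finToFun-funToFin)
open import Data.Fin.Subset using (∣_∣)
import Data.Integer.Base as ℤ
import Data.Integer.Properties as ℤ
open import Data.List.Base using (List; []; _∷_; map; length; reverse)
open import Data.List.Properties using (length-map; tabulate-cong)
open import Data.List.Relation.Binary.Permutation.Propositional as ↭ using (_↭_; ↭-sym; ↭-trans; ↭⇒↭ₛ)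
open import Data.List.Relation.Binary.Permutation.Propositional.Properties using (↭-length)
open import Data.List.Relation.Binary.Pointwise using (Pointwise-≡⇒≡)
open import Data.List.Relation.Unary.Linked using ([-]; _∷_)
open import Data.List.Relation.Unary.Sorted.TotalOrder.Properties using (↗↭↗⇒≋)
import Data.List.Sort.Base
import Data.List.Sort.InsertionSort as InsertionSort
open import Data.Nat.Base hiding (_/_)
open import Data.Nat.Coprimality using (Coprime; coprime-divisor)
open import Data.Nat.Divisibility
open import Data.Nat.GeneralisedArithmetic using (iterate)
open import Data.Nat.Properties
open import Data.Nat.Tactic.RingSolver using (solve-∀)
open import Data.Product.Base using (_×_; _,_; proj₁; proj₂; ∃-syntax; ∃₂; map₂)
open import Data.Rational.Base as ℚ using (_/_; toℚᵘ)
import Data.Rational.Properties as ℚ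
open import Data.Rational.Unnormalised.Base as ℚᵘ using (mkℚᵘ; *≡*)
import Data.Rational.Unnormalised.Properties as ℚᵘ
import Data.Vec.Base as Vec
open import Data.Sum.Base using (_⊎_; inj₁; inj₂; [_,_]′)
open import Function.Base using (_∘_)
open import Function.Bundles using (mk⇔)
open import Relation.Binary.Definitions using (tri<; tri≈; tri>)
open import Relation.Binary.PropositionalEquality
open import Relation.Nullary.Decidable using (Dec; yes; no; does; does-⇔; dec-true; dec-false)
open import Relation.Nullary.Negation using (¬_; contradiction)

open Algebra.Properties.Semiring.Sum +-*-semiring
  using (sum; sum-cong-≗; ∑-distrib-+)
open Data.List.Sort.Base ≤-totalOrder using (module SortingAlgorithm)
open InsertionSort ≤-decTotalOrder using (sort; insert; insertionSort)
open SortingAlgorithm insertionSort using (sort-↭; sort-↗)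
open import Data.List.Relation.Unary.Sorted.TotalOrder ≤-totalOrder using (Sorted)

-- Finite sums

-- For E > 0 the digits of K(x) are D, E - 1, b - 1 - E and b - D. They form two pairs with sums b
-- and b - 2, that is, two intervals whose centres differ by 1. This displacement is the obstacle:
-- if both intervals have width u, they overlap without nesting and the new gaps u + 1 and |u - 1|
-- need no longer be multiples of `m`. An odd `m` > 1 cannot divide both of these numbers, since it
-- would divide 2 (or 1 if u = 0). Nor can it divide both gaps obtained from E = 0, which add up to
-- b - 1. So every predecessor of a pair of the required kind is regular. Convergence needs no
-- estimate: after `n` steps the scale is g = 2ⁿ m with b = 5 g, and the coefficients 1, 4 fold to 3
-- while 2, 3 fold to 1. For the count, the weights (b - D) (D - E) arise as iterated partial sums
-- of a function that is periodic modulo 5. Identities are multiplied out or rearranged so that they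
-- stay within the natural numbers.

∑< : ℕ → (ℕ → ℕ) → ℕ
∑< zero    f = 0
∑< (suc n) f = f 0 + ∑< n (f ∘ suc)

syntax ∑< n (λ i → e) = ∑[ i < n ] e

∑<≡sum : ∀ n f → ∑< n f ≡ sum {n} (f ∘ toℕ)
∑<≡sum zero    f = refl
∑<≡sum (suc n) f = cong (f 0 +_) (∑<≡sum n (f ∘ suc))

∑-cong< : ∀ n {f g : ℕ → ℕ} → (∀ i → i < n → f i ≡ g i) → ∑< n f ≡ ∑< n g
∑-cong< zero    eq = refl
∑-cong< (suc n) eq = cong₂ _+_ (eq 0 z<s) (∑-cong< n (λ i i<n → eq (suc i) (s<s i<n)))

∑-cong : ∀ n {f g : ℕ → ℕ} → f ≗ g → ∑< n f ≡ ∑< n g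
∑-cong n eq = ∑-cong< n (λ i _ → eq i)

∑-+ : ∀ n (f g : ℕ → ℕ) → ∑[ i < n ] (f i + g i) ≡ ∑< n f + ∑< n g
∑-+ n f g
  rewrite ∑<≡sum n f | ∑<≡sum n g | ∑<≡sum n (λ i → f i + g i) =
  ∑-distrib-+ {n} (f ∘ toℕ) (g ∘ toℕ)

∑-zero : ∀ n {f : ℕ → ℕ} → (∀ i → f i ≡ 0) → ∑< n f ≡ 0
∑-zero zero    eq = refl
∑-zero (suc n) eq = cong₂ _+_ (eq 0) (∑-zero n (eq ∘ suc))

∑-swap : ∀ m n (f : ℕ → ℕ → ℕ) →
         ∑[ i < m ] (∑[ j < n ] f i j) ≡ ∑[ j < n ] (∑[ i < m ] f i j)
∑-swap zero    n f = sym (∑-zero n (λ _ → refl))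
∑-swap (suc m) n f = trans (cong (∑< n (f 0) +_) (∑-swap m n (f ∘ suc))) (sym (∑-+ n _ _))

∑-*ˡ : ∀ n c (f : ℕ → ℕ) → ∑[ i < n ] (c * f i) ≡ c * ∑< n f
∑-*ˡ zero    c f = sym (*-zeroʳ c)
∑-*ˡ (suc n) c f = trans (cong (c * f 0 +_) (∑-*ˡ n c (f ∘ suc))) (sym (*-distribˡ-+ c (f 0) _))

sum-++ : ∀ m {n} (f : Fin (m + n) → ℕ) →
         sum f ≡ sum (λ i → f (i ↑ˡ n)) + sum (λ j → f (m ↑ʳ j))
sum-++ zero    f = refl
sum-++ (suc m) f = trans (cong (f zero +_) (sum-++ m (f ∘ suc))) (sym (+-assoc (f zero) _ _))

sum-combine : ∀ m {n} (f : Fin (m * n) → ℕ) →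
              sum f ≡ sum {m} (λ i → sum {n} (λ j → f (combine i j)))
sum-combine zero    f = refl
sum-combine (suc m) {n} f = trans (sum-++ n f) (cong (sum (λ j → f (j ↑ˡ (m * n))) +_) (sum-combine m (λ i → f (n ↑ʳ i))))

⟦_⟧ : Bool → ℕ
⟦ b ⟧ = if b then 1 else 0

card-tabulate : ∀ {n} (f : Fin n → Bool) → ∣ Vec.tabulate f ∣ ≡ sum (λ i → ⟦ f i ⟧)
card-tabulate {zero}  f = refl
card-tabulate {suc n} f with f zero
... | true  = cong suc (card-tabulate (λ i → f (suc i)))
... | false = card-tabulate (λ i → f (suc i))

<ᵇ-suc : ∀ m n → (m <ᵇ suc n) ≡ not (n <ᵇ m)
<ᵇ-suc zero    n       = refl
<ᵇ-suc (suc m) zero    = refl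
<ᵇ-suc (suc m) (suc n) = <ᵇ-suc m n

∑-from : ∀ n s (h : ℕ → ℕ) →
         ∑[ i < n ] (if i <ᵇ s then 0 else h i) ≡ ∑[ i < n ∸ s ] h (s + i)
∑-from n       zero    h = refl
∑-from zero    (suc s) h = refl
∑-from (suc n) (suc s) h = ∑-from n s (h ∘ suc)

∑-upto : ∀ {n N} → n ≤ N → (h : ℕ → ℕ) →
         ∑[ i < N ] (if i <ᵇ n then h i else 0) ≡ ∑< n h
∑-upto {N = N} z≤n h = ∑-zero N (λ _ → refl)
∑-upto (s≤s n≤N)   h = cong (h 0 +_) (∑-upto n≤N (h ∘ suc))

∑-const : ∀ n c → ∑[ i < n ] c ≡ n * c
∑-const zero    c = refl
∑-const (suc n) c = cong (c +_) (∑-const n c)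

+-<ᵇ-∸ : ∀ k m n → (k + m <ᵇ n) ≡ (m <ᵇ n ∸ k)
+-<ᵇ-∸ zero    m n       = refl
+-<ᵇ-∸ (suc k) m zero    = refl
+-<ᵇ-∸ (suc k) m (suc n) = +-<ᵇ-∸ k m n

<ᵇ-∸-swap : ∀ n i j → (j <ᵇ n ∸ i) ≡ (i <ᵇ n ∸ j)
<ᵇ-∸-swap n i j = trans (sym (+-<ᵇ-∸ i j n)) (trans (cong (_<ᵇ n) (+-comm i j)) (+-<ᵇ-∸ j i n))

-- Each j occurs once for every i < n ∸ j.
∑-triangle : ∀ {n} N {N′} → n ≤ N → n ≤ N′ → (h : ℕ → ℕ) →
             ∑[ i < N ] (∑[ j < n ∸ i ] h j) ≡ ∑[ j < N′ ] ((n ∸ j) * h j)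
∑-triangle {n} N {N′} n≤N n≤N′ h = begin
  ∑[ i < N ] (∑[ j < n ∸ i ] h j)
    ≡⟨ ∑-cong N (λ i → sym (∑-upto (≤-trans (m∸n≤m n i) n≤N′) h)) ⟩
  ∑[ i < N ] (∑[ j < N′ ] (if j <ᵇ n ∸ i then h j else 0))
    ≡⟨ ∑-swap N N′ _ ⟩
  ∑[ j < N′ ] (∑[ i < N ] (if j <ᵇ n ∸ i then h j else 0))
    ≡⟨ ∑-cong N′ (λ j → ∑-cong N (λ i → cong (if_then h j else 0) (<ᵇ-∸-swap n i j))) ⟩
  ∑[ j < N′ ] (∑[ i < N ] (if i <ᵇ n ∸ j then h j else 0))
    ≡⟨ ∑-cong N′ (λ j → trans (∑-upto (≤-trans (m∸n≤m n j) n≤N) (λ _ → h j)) (∑-const (n ∸ j) (h j))) ⟩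
  ∑[ j < N′ ] ((n ∸ j) * h j) ∎
  where open ≡-Reasoning

m<n⇒∃[o]o+1+m≡n : ∀ {m n} → m < n → ∃[ o ] suc o + m ≡ n
m<n⇒∃[o]o+1+m≡n {m} {n} m<n = n ∸ suc m , trans (sym (+-suc _ m)) (m∸n+n≡m m<n)

m<n∸o⇒o+m<n : ∀ o {m n} → m < n ∸ o → o + m < n
m<n∸o⇒o+m<n zero              m<n   = m<n
m<n∸o⇒o+m<n (suc o) {n = suc n} m<n∸o = s<s (m<n∸o⇒o+m<n o m<n∸o)

∑-interval : ∀ {N} lo {hi} → hi ≤ N → (h : ℕ → ℕ) →
             ∑[ i < N ] (if i <ᵇ lo then 0 else if i <ᵇ hi then h (i ∸ lo) else 0)
               ≡ ∑< (hi ∸ lo) h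
∑-interval {N} lo {hi} hi≤N h = begin
  ∑[ i < N ] (if i <ᵇ lo then 0 else if i <ᵇ hi then h (i ∸ lo) else 0)
    ≡⟨ ∑-from N lo _ ⟩
  ∑[ i < N ∸ lo ] (if lo + i <ᵇ hi then h (lo + i ∸ lo) else 0)
    ≡⟨ ∑-cong (N ∸ lo) (λ i → cong₂ (if_then_else 0) (+-<ᵇ-∸ lo i hi) (cong h (m+n∸m≡n lo i))) ⟩
  ∑[ i < N ∸ lo ] (if i <ᵇ hi ∸ lo then h i else 0)
    ≡⟨ ∑-upto (∸-monoˡ-≤ lo hi≤N) h ⟩
  ∑< (hi ∸ lo) h ∎
  where open ≡-Reasoning

if-not : ∀ {a} {A : Set a} c {x y : A} → (if not c then x else y) ≡ (if c then y else x)
if-not true  = refl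
if-not false = refl

∑-if : ∀ n c {f : ℕ → ℕ} → ∑[ i < n ] (if c then 0 else f i) ≡ (if c then 0 else ∑< n f)
∑-if n true  = ∑-zero n (λ _ → refl)
∑-if n false = refl

-- Counting quadruples of digits by their gaps

∑⁴ : ℕ → (ℕ → ℕ → ℕ → ℕ → ℕ) → ℕ
∑⁴ b F = ∑[ w < b ] (∑[ x < b ] (∑[ y < b ] (∑[ z < b ] F w x y z)))

module _ (b : ℕ) where

  ∑⁴-cong : ∀ {F G : ℕ → ℕ → ℕ → ℕ → ℕ} → (∀ w x y z → F w x y z ≡ G w x y z) → ∑⁴ b F ≡ ∑⁴ b G
  ∑⁴-cong eq = ∑-cong b (λ w → ∑-cong b (λ x → ∑-cong b (λ y → ∑-cong b (λ z → eq w x y z))))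

  ∑⁴-+ : ∀ F G → ∑⁴ b (λ w x y z → F w x y z + G w x y z) ≡ ∑⁴ b F + ∑⁴ b G
  ∑⁴-+ F G =
    trans (∑-cong b (λ w →
      trans (∑-cong b (λ x →
        trans (∑-cong b (λ y → ∑-+ b (F w x y) (G w x y)))
              (∑-+ b _ _)))
            (∑-+ b _ _)))
          (∑-+ b _ _)

  ∑⁴-swap₁₂ : ∀ F → ∑⁴ b (λ w x y z → F x w y z) ≡ ∑⁴ b F
  ∑⁴-swap₁₂ F = ∑-swap b b _

  ∑⁴-swap₂₃ : ∀ F → ∑⁴ b (λ w x y z → F w y x z) ≡ ∑⁴ b F
  ∑⁴-swap₂₃ F = ∑-cong b (λ w → ∑-swap b b _)

  ∑⁴-swap₃₄ : ∀ F → ∑⁴ b (λ w x y z → F w x z y) ≡ ∑⁴ b F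
  ∑⁴-swap₃₄ F = ∑-cong b (λ w → ∑-cong b (λ x → ∑-swap b b _))

-- Insertion sort on the arguments: each value is moved into the sorted tail by adjacent
-- transpositions, so invariance under the three adjacent swaps is enough.
wlog-sorted : (P : ℕ → ℕ → ℕ → ℕ → Set) →
  (∀ {w x y z} → P w x y z → P x w y z) →
  (∀ {w x y z} → P w x y z → P w y x z) →
  (∀ {w x y z} → P w x y z → P w x z y) →
  (∀ {w x y z} → z ≤ y → y ≤ x → x ≤ w → P w x y z) →
  ∀ w x y z → P w x y z
wlog-sorted P s₁₂ s₂₃ s₃₄ base = all
  where
  insert₁ : ∀ w {x y z} → z ≤ y → y ≤ x → P w x y z
  insert₁ w {x} {y} {z} z≤y y≤x with ≤-total x w
  ... | inj₁ x≤w = base z≤y y≤x x≤w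
  ... | inj₂ w≤x with ≤-total y w
  ...   | inj₁ y≤w = s₁₂ (base z≤y y≤w w≤x)
  ...   | inj₂ w≤y with ≤-total z w
  ...     | inj₁ z≤w = s₁₂ (s₂₃ (base z≤w w≤y y≤x))
  ...     | inj₂ w≤z = s₁₂ (s₂₃ (s₃₄ (base w≤z z≤y y≤x)))

  insert₂ : ∀ w x {y z} → z ≤ y → P w x y z
  insert₂ w x {y} {z} z≤y with ≤-total y x
  ... | inj₁ y≤x = insert₁ w z≤y y≤x
  ... | inj₂ x≤y with ≤-total z x
  ...   | inj₁ z≤x = s₂₃ (insert₁ w z≤x x≤y)
  ...   | inj₂ x≤z = s₂₃ (s₃₄ (insert₁ w x≤z z≤y))

  all : ∀ w x y z → P w x y z
  all w x y z with ≤-total z y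
  ... | inj₁ z≤y = insert₂ w x z≤y
  ... | inj₂ y≤z = s₃₄ (insert₂ w x y≤z)

<⇒<ᵇ≡true : ∀ {m n} → m < n → (m <ᵇ n) ≡ true
<⇒<ᵇ≡true {zero}  {suc n} _         = refl
<⇒<ᵇ≡true {suc m} {suc n} (s≤s m<n) = <⇒<ᵇ≡true m<n

≤⇒<ᵇ≡false : ∀ {m n} → m ≤ n → (n <ᵇ m) ≡ false
≤⇒<ᵇ≡false {zero}            z≤n       = refl
≤⇒<ᵇ≡false {suc m} {suc n} (s≤s m≤n) = ≤⇒<ᵇ≡false m≤n

module Gaps (g : ℕ → ℕ → ℕ) (g-zero : ∀ n → g n 0 ≡ 0) (g-diag : ∀ n → g n n ≡ 0) where

  -- Fix the smallest digit and gaps 0 < E < D. The inner pair has D - E + 1 positions between the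
  -- outer digits; D - E - 1 of them avoid ties and give 24 inputs each, while the two at the ends
  -- give 12 each. Counting arrangements once with `weak` and once with `strict` inequalities
  -- therefore yields twice 24 (D - E), and no multinomial coefficients are needed.
  weak strict nested : ℕ → ℕ → ℕ → ℕ → ℕ
  weak s p r q = if r <ᵇ s then 0 else if q <ᵇ r then 0 else
                 if p <ᵇ q then 0 else g (p ∸ s) (q ∸ r)
  strict s p r q = if s <ᵇ r then (if q <ᵇ r then 0 else
                   if q <ᵇ p then g (p ∸ s) (q ∸ r) else 0) else 0
  nested s p r q = if p <ᵇ s then 0 else weak s p r q + strict s p r q

  pairs : ℕ → ℕ → ℕ → ℕ → ℕ
  pairs a b c d = (nested a b c d + nested b a c d) + (nested a b d c + nested b a d c)

  -- The six summands choose which two values are the outer ones; `pairs` then orders the outer and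
  -- the inner values, which makes 24 arrangements.
  permutations : ℕ → ℕ → ℕ → ℕ → ℕ
  permutations w x y z =
    (pairs w x y z + pairs y z w x) + (pairs w y x z + pairs x z w y) + (pairs w z x y + pairs x y w z)

  pairs-swapˡ : ∀ a b c d → pairs a b c d ≡ pairs b a c d
  pairs-swapˡ a b c d = cong₂ _+_ (+-comm (nested a b c d) _) (+-comm (nested a b d c) _)

  pairs-swapʳ : ∀ a b c d → pairs a b c d ≡ pairs a b d c
  pairs-swapʳ a b c d = +-comm (nested a b c d + nested b a c d) _

  permutations-swap₁₂ : ∀ w x y z → permutations w x y z ≡ permutations x w y z
  permutations-swap₁₂ w x y z
    rewrite pairs-swapˡ w x y z | pairs-swapʳ y z w x =
    lem (pairs x w y z + pairs y z x w) (pairs w y x z) (pairs x z w y) (pairs w z x y) (pairs x y w z)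
    where
    lem : ∀ p a b c d → p + (a + b) + (c + d) ≡ p + (d + c) + (b + a)
    lem = solve-∀

  permutations-swap₂₃ : ∀ w x y z → permutations w x y z ≡ permutations w y x z
  permutations-swap₂₃ w x y z
    rewrite pairs-swapʳ w z x y | pairs-swapˡ x y w z =
    lem (pairs w z y x + pairs y x w z) (pairs w x y z) (pairs y z w x) (pairs w y x z) (pairs x z w y)
    where
    lem : ∀ p a b c d → (a + b) + (c + d) + p ≡ (c + d) + (a + b) + p
    lem = solve-∀

  permutations-swap₃₄ : ∀ w x y z → permutations w x y z ≡ permutations w x z y
  permutations-swap₃₄ w x y z
    rewrite pairs-swapʳ w x y z | pairs-swapˡ y z w x =
    lem (pairs w x z y + pairs z y w x) (pairs w y x z) (pairs x z w y) (pairs w z x y) (pairs x y w z)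
    where
    lem : ∀ p a b c d → p + (a + b) + (c + d) ≡ p + (c + d) + (a + b)
    lem = solve-∀

  tie-low : ∀ n → ((n + 0) + 0) + ((n + 0) + 0) ≡ n + (n + 0)
  tie-low = solve-∀

  tie-high : ∀ n → (n + 0) + ((n + 0) + 0) ≡ n + (n + 0)
  tie-high = solve-∀

  -- The two hypotheses on `g` dispose of the degenerate orders: `x = y` gives E = 0, and `z = y`
  -- together with `x = w` gives D = E. What remains has four distinct values or a single tie at one
  -- end.
  permutations-sorted : ∀ {w x y z} → z ≤ y → y ≤ x → x ≤ w →
                        permutations w x y z ≡ 2 * g (w ∸ z) (x ∸ y)
  permutations-sorted {w} {x} {y} {z} z≤y y≤x x≤w with m≤n⇒m<n∨m≡n y≤x
  permutations-sorted {w} {x} {x} {z} z≤y y≤x x≤w | inj₂ refl with m≤n⇒m<n∨m≡n z≤y | m≤n⇒m<n∨m≡n x≤w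
  ... | inj₁ z<x | inj₁ x<w
    rewrite <⇒<ᵇ≡true z<x | <⇒<ᵇ≡true x<w | <⇒<ᵇ≡true (<-trans z<x x<w)
          | ≤⇒<ᵇ≡false z≤y | ≤⇒<ᵇ≡false x≤w | ≤⇒<ᵇ≡false (≤-trans z≤y x≤w)
          | ≤⇒<ᵇ≡false (≤-refl {x})
          | n∸n≡0 x | g-zero (w ∸ z) = refl
  ... | inj₂ refl | inj₁ x<w
    rewrite <⇒<ᵇ≡true x<w | ≤⇒<ᵇ≡false x≤w | ≤⇒<ᵇ≡false (≤-refl {x})
          | n∸n≡0 x | g-zero (w ∸ x) = refl
  ... | inj₁ z<x | inj₂ refl
    rewrite <⇒<ᵇ≡true z<x | ≤⇒<ᵇ≡false z≤y | ≤⇒<ᵇ≡false (≤-refl {x})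
          | n∸n≡0 x | g-zero (x ∸ z) = refl
  ... | inj₂ refl | inj₂ refl
    rewrite ≤⇒<ᵇ≡false (≤-refl {x}) | n∸n≡0 x | g-zero 0 = refl
  permutations-sorted {w} {x} {y} {z} z≤y y≤x x≤w | inj₁ y<x with m≤n⇒m<n∨m≡n z≤y | m≤n⇒m<n∨m≡n x≤w
  ... | inj₁ z<y | inj₁ x<w
    rewrite <⇒<ᵇ≡true z<y | <⇒<ᵇ≡true x<w | <⇒<ᵇ≡true y<x
          | <⇒<ᵇ≡true (<-trans z<y y<x) | <⇒<ᵇ≡true (<-trans y<x x<w) | <⇒<ᵇ≡true (<-trans z<y (<-trans y<x x<w))
          | ≤⇒<ᵇ≡false z≤y | ≤⇒<ᵇ≡false x≤w | ≤⇒<ᵇ≡false y≤x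
          | ≤⇒<ᵇ≡false (≤-trans z≤y y≤x) | ≤⇒<ᵇ≡false (≤-trans y≤x x≤w) | ≤⇒<ᵇ≡false (≤-trans z≤y (≤-trans y≤x x≤w))
          = +-assoc (g (w ∸ z) (x ∸ y)) _ 0
  ... | inj₂ refl | inj₁ x<w
    rewrite <⇒<ᵇ≡true x<w | <⇒<ᵇ≡true y<x | <⇒<ᵇ≡true (<-trans y<x x<w)
          | ≤⇒<ᵇ≡false x≤w | ≤⇒<ᵇ≡false y≤x | ≤⇒<ᵇ≡false (≤-trans y≤x x≤w) | ≤⇒<ᵇ≡false (≤-refl {y})
          = tie-low (g (w ∸ y) (x ∸ y))
  ... | inj₁ z<y | inj₂ refl
    rewrite <⇒<ᵇ≡true z<y | <⇒<ᵇ≡true y<x | <⇒<ᵇ≡true (<-trans z<y y<x)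
          | ≤⇒<ᵇ≡false z≤y | ≤⇒<ᵇ≡false y≤x | ≤⇒<ᵇ≡false (≤-trans z≤y y≤x) | ≤⇒<ᵇ≡false (≤-refl {x})
          = tie-high (g (x ∸ z) (x ∸ y))
  ... | inj₂ refl | inj₂ refl
    rewrite <⇒<ᵇ≡true y<x | ≤⇒<ᵇ≡false y≤x | ≤⇒<ᵇ≡false (≤-refl {x}) | ≤⇒<ᵇ≡false (≤-refl {y})
          | g-diag (x ∸ y) = refl

  module _ (b : ℕ) where

    ∑-weak : ∀ s D → D < b ∸ s →
             ∑[ r < b ] (∑[ q < b ] weak s (s + D) r q) ≡ ∑[ E < b ] ((suc D ∸ E) * g D E)
    ∑-weak s D D<b∸s = begin
      ∑[ r < b ] (∑[ q < b ] weak s (s + D) r q)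
        ≡⟨ ∑-cong b (λ r → ∑-if b (r <ᵇ s)) ⟩
      ∑[ r < b ] (if r <ᵇ s then 0 else row r)
        ≡⟨ ∑-from b s row ⟩
      ∑[ ρ < b ∸ s ] row (s + ρ)
        ≡⟨ ∑-cong (b ∸ s) (λ ρ → trans (row≡ (s + ρ)) (cong (λ n → ∑< n (g D)) (lower ρ))) ⟩
      ∑[ ρ < b ∸ s ] (∑[ E < suc D ∸ ρ ] g D E)
        ≡⟨ ∑-triangle (b ∸ s) D<b∸s (≤-trans D<b∸s (m∸n≤m b s)) (g D) ⟩
      ∑[ E < b ] ((suc D ∸ E) * g D E) ∎
      where
      open ≡-Reasoning
      row : ℕ → ℕ
      row r = ∑[ q < b ] (if q <ᵇ r then 0 else if s + D <ᵇ q then 0 else g (s + D ∸ s) (q ∸ r))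
      s+D<b : s + D < b
      s+D<b = m<n∸o⇒o+m<n s D<b∸s
      row≡ : ∀ r → row r ≡ ∑< (suc (s + D) ∸ r) (g D)
      row≡ r = trans (∑-cong b (λ q → cong (if q <ᵇ r then 0 else_)
        (trans (sym (if-not (s + D <ᵇ q)))
               (cong₂ (if_then_else 0) (sym (<ᵇ-suc q (s + D))) (cong (λ d → g d (q ∸ r)) (m+n∸m≡n s D))))))
        (∑-interval r s+D<b (g D))
      lower : ∀ ρ → suc (s + D) ∸ (s + ρ) ≡ suc D ∸ ρ
      lower ρ = trans (cong (_∸ (s + ρ)) (sym (+-suc s D))) ([m+n]∸[m+o]≡n∸o s (suc D) ρ)

    ∑-strict : ∀ s D → D < b ∸ s →
               ∑[ r < b ] (∑[ q < b ] strict s (s + D) r q) ≡ ∑[ E < b ] ((D ∸ 1 ∸ E) * g D E)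
    ∑-strict s D D<b∸s = begin
      ∑[ r < b ] (∑[ q < b ] strict s (s + D) r q)
        ≡⟨ ∑-cong b (λ r → trans (∑-cong b (λ q → trans (sym (if-not (s <ᵇ r)))
             (cong (if_then 0 else cell r q) (sym (<ᵇ-suc r s))))) (∑-if b (r <ᵇ suc s))) ⟩
      ∑[ r < b ] (if r <ᵇ suc s then 0 else row r)
        ≡⟨ ∑-from b (suc s) row ⟩
      ∑[ ρ < b ∸ suc s ] row (suc s + ρ)
        ≡⟨ ∑-cong (b ∸ suc s) (λ ρ → trans (row≡ (suc s + ρ)) (cong (λ n → ∑< n (g D)) (lower ρ))) ⟩
      ∑[ ρ < b ∸ suc s ] (∑[ E < D ∸ 1 ∸ ρ ] g D E)
        ≡⟨ ∑-triangle (b ∸ suc s) D-1≤ (≤-trans D-1≤ (m∸n≤m b (suc s))) (g D) ⟩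
      ∑[ E < b ] ((D ∸ 1 ∸ E) * g D E) ∎
      where
      open ≡-Reasoning
      cell : ℕ → ℕ → ℕ
      cell r q = if q <ᵇ r then 0 else if q <ᵇ s + D then g (s + D ∸ s) (q ∸ r) else 0
      row : ℕ → ℕ
      row r = ∑[ q < b ] cell r q
      D-1≤ : D ∸ 1 ≤ b ∸ suc s
      D-1≤ = ≤-trans (∸-monoˡ-≤ 1 (<⇒≤ D<b∸s)) (≤-reflexive (trans (∸-+-assoc b s 1) (cong (b ∸_) (+-comm s 1))))
      s+D≤b : s + D ≤ b
      s+D≤b = <⇒≤ (m<n∸o⇒o+m<n s D<b∸s)
      row≡ : ∀ r → row r ≡ ∑< (s + D ∸ r) (g D)
      row≡ r = trans (∑-cong b (λ q → cong (if q <ᵇ r then 0 else_)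
          (cong (λ d → if q <ᵇ s + D then g d (q ∸ r) else 0) (m+n∸m≡n s D))))
        (∑-interval r s+D≤b (g D))
      lower : ∀ ρ → s + D ∸ (suc s + ρ) ≡ D ∸ 1 ∸ ρ
      lower ρ = trans (cong (s + D ∸_) (sym (+-suc s ρ))) (trans ([m+n]∸[m+o]≡n∸o s D (suc ρ)) (sym (∸-+-assoc D 1 ρ)))

    -- The average of D - E + 1 and D - E - 1. Truncation spoils it only at `E = D`, where the
    -- factors are 1 and 0; there `g-diag` removes the term.
    2[D∸E] : ∀ D E → (suc D ∸ E) * g D E + (D ∸ 1 ∸ E) * g D E ≡ 2 * ((D ∸ E) * g D E)
    2[D∸E] D E with <-cmp E D
    ... | tri≈ _ refl _ rewrite g-diag E | *-zeroʳ (suc E ∸ E) | *-zeroʳ (E ∸ 1 ∸ E) | *-zeroʳ (E ∸ E) = refl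
    ... | tri> _ _ D<E
      rewrite m≤n⇒m∸n≡0 D<E | m≤n⇒m∸n≡0 (<⇒≤ D<E) | m≤n⇒m∸n≡0 (≤-trans (m∸n≤m D 1) (<⇒≤ D<E)) = refl
    ... | tri< E<D _ _ with c , refl ← m<n⇒∃[o]o+1+m≡n E<D
      rewrite m+n∸n≡m c E | m+n∸n≡m (suc c) E | m+n∸n≡m (suc (suc c)) E = lem c (g (suc c + E) E)
      where
      lem : ∀ c x → suc (suc c) * x + c * x ≡ 2 * (suc c * x)
      lem = solve-∀

    ∑⁴-nested : ∑⁴ b nested ≡ 2 * ∑[ D < b ] ((b ∸ D) * ∑[ E < b ] ((D ∸ E) * g D E))
    ∑⁴-nested = begin
      ∑⁴ b nested
        ≡⟨ ∑-cong b (λ s → ∑-cong b (λ p → trans (∑-cong b (λ r → ∑-if b (p <ᵇ s))) (∑-if b (p <ᵇ s)))) ⟩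
      ∑[ s < b ] (∑[ p < b ] (if p <ᵇ s then 0 else inner s p))
        ≡⟨ ∑-cong b (λ s → ∑-from b s (inner s)) ⟩
      ∑[ s < b ] (∑[ D < b ∸ s ] inner s (s + D))
        ≡⟨ ∑-cong b (λ s → ∑-cong< (b ∸ s) (inner≡ s)) ⟩
      ∑[ s < b ] (∑[ D < b ∸ s ] (2 * moment D))
        ≡⟨ ∑-triangle b ≤-refl ≤-refl (λ D → 2 * moment D) ⟩
      ∑[ D < b ] ((b ∸ D) * (2 * moment D))
        ≡⟨ ∑-cong b (λ D → x*2y (b ∸ D) (moment D)) ⟩
      ∑[ D < b ] (2 * ((b ∸ D) * moment D))
        ≡⟨ ∑-*ˡ b 2 _ ⟩
      2 * ∑[ D < b ] ((b ∸ D) * moment D) ∎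
      where
      open ≡-Reasoning
      inner : ℕ → ℕ → ℕ
      inner s p = ∑[ r < b ] (∑[ q < b ] (weak s p r q + strict s p r q))
      moment : ℕ → ℕ
      moment D = ∑[ E < b ] ((D ∸ E) * g D E)
      x*2y : ∀ x y → x * (2 * y) ≡ 2 * (x * y)
      x*2y = solve-∀
      inner≡ : ∀ s D → D < b ∸ s → inner s (s + D) ≡ 2 * moment D
      inner≡ s D D<b∸s = begin
        inner s (s + D)
          ≡⟨ trans (∑-cong b (λ r → ∑-+ b _ _)) (∑-+ b _ _) ⟩
        ∑[ r < b ] (∑[ q < b ] weak s (s + D) r q) + ∑[ r < b ] (∑[ q < b ] strict s (s + D) r q)
          ≡⟨ cong₂ _+_ (∑-weak s D D<b∸s) (∑-strict s D D<b∸s) ⟩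
        ∑[ E < b ] ((suc D ∸ E) * g D E) + ∑[ E < b ] ((D ∸ 1 ∸ E) * g D E)
          ≡⟨ ∑-+ b _ _ ⟨
        ∑[ E < b ] ((suc D ∸ E) * g D E + (D ∸ 1 ∸ E) * g D E)
          ≡⟨ ∑-cong b (2[D∸E] D) ⟩
        ∑[ E < b ] (2 * ((D ∸ E) * g D E))
          ≡⟨ ∑-*ˡ b 2 _ ⟩
        2 * moment D ∎

    ∑⁴-pairs : ∑⁴ b pairs ≡ 4 * ∑⁴ b nested
    ∑⁴-pairs = begin
      ∑⁴ b pairs
        ≡⟨ trans (∑⁴-+ b _ _) (cong₂ _+_ (∑⁴-+ b _ _) (∑⁴-+ b _ _)) ⟩
      (∑⁴ b nested + ∑⁴ b (λ a b c d → nested b a c d)) +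
      (∑⁴ b (λ a b c d → nested a b d c) + ∑⁴ b (λ a b c d → nested b a d c))
        ≡⟨ cong₂ _+_ (cong (∑⁴ b nested +_) (∑⁴-swap₁₂ b nested))
                     (cong₂ _+_ (∑⁴-swap₃₄ b nested)
                        (trans (∑⁴-swap₁₂ b (λ a b c d → nested a b d c)) (∑⁴-swap₃₄ b nested))) ⟩
      (∑⁴ b nested + ∑⁴ b nested) + (∑⁴ b nested + ∑⁴ b nested)
        ≡⟨ lem (∑⁴ b nested) ⟩
      4 * ∑⁴ b nested ∎
      where
      open ≡-Reasoning
      lem : ∀ n → (n + n) + (n + n) ≡ 4 * n
      lem = solve-∀

    ∑⁴-permutations : ∑⁴ b permutations ≡ 24 * ∑⁴ b nested
    ∑⁴-permutations = begin
      ∑⁴ b permutations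
        ≡⟨ trans (∑⁴-+ b _ _) (cong₂ _+_ (trans (∑⁴-+ b _ _) (cong₂ _+_ (∑⁴-+ b _ _) (∑⁴-+ b _ _))) (∑⁴-+ b _ _)) ⟩
      (∑⁴ b pairs + ∑⁴ b (λ w x y z → pairs y z w x)) +
      (∑⁴ b (λ w x y z → pairs w y x z) + ∑⁴ b (λ w x y z → pairs x z w y)) +
      (∑⁴ b (λ w x y z → pairs w z x y) + ∑⁴ b (λ w x y z → pairs x y w z))
        ≡⟨ cong₂ _+_ (cong₂ _+_ (cong (n +_) eq₂) (cong₂ _+_ eq₃ eq₄)) (cong₂ _+_ eq₅ eq₆) ⟩
      (n + n) + (n + n) + (n + n)
        ≡⟨ cong (λ n → (n + n) + (n + n) + (n + n)) ∑⁴-pairs ⟩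
      (4 * N + 4 * N) + (4 * N + 4 * N) + (4 * N + 4 * N)
        ≡⟨ lem N ⟩
      24 * N ∎
      where
      open ≡-Reasoning
      N = ∑⁴ b nested
      n = ∑⁴ b pairs
      lem : ∀ n → (4 * n + 4 * n) + (4 * n + 4 * n) + (4 * n + 4 * n) ≡ 24 * n
      lem = solve-∀
      eq₃ : ∑⁴ b (λ w x y z → pairs w y x z) ≡ n
      eq₃ = ∑⁴-swap₂₃ b pairs
      eq₅ : ∑⁴ b (λ w x y z → pairs w z x y) ≡ n
      eq₅ = trans (∑⁴-swap₃₄ b (λ w x y z → pairs w y x z)) eq₃
      eq₆ : ∑⁴ b (λ w x y z → pairs x y w z) ≡ n
      eq₆ = trans (∑⁴-swap₁₂ b (λ w x y z → pairs w y x z)) eq₃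
      eq₄ : ∑⁴ b (λ w x y z → pairs x z w y) ≡ n
      eq₄ = trans (∑⁴-swap₃₄ b (λ w x y z → pairs x y w z)) eq₆
      eq₂ : ∑⁴ b (λ w x y z → pairs y z w x) ≡ n
      eq₂ = trans (∑⁴-swap₂₃ b (λ w x y z → pairs x z w y)) eq₄

    -- For distinct digits w > x > y > z exactly one of the 24 arrangements is
    -- nested, weakly and strictly; with ties two arrangements are weakly nested
    -- and none is strictly nested, unless the summand vanishes.
    ∑⁴-sorted : (F : ℕ → ℕ → ℕ → ℕ → ℕ) →
                (∀ w x y z → F w x y z ≡ F x w y z) →
                (∀ w x y z → F w x y z ≡ F w y x z) →
                (∀ w x y z → F w x y z ≡ F w x z y) →
                (∀ {w x y z} → z ≤ y → y ≤ x → x ≤ w → F w x y z ≡ g (w ∸ z) (x ∸ y)) →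
                ∑⁴ b F ≡ 24 * ∑[ D < b ] ((b ∸ D) * ∑[ E < b ] ((D ∸ E) * g D E))
    ∑⁴-sorted F F₁₂ F₂₃ F₃₄ F-sorted = *-cancelˡ-≡ _ _ 2 (begin
      2 * ∑⁴ b F                  ≡⟨ cong (∑⁴ b F +_) (+-identityʳ _) ⟩
      ∑⁴ b F + ∑⁴ b F             ≡⟨ ∑⁴-+ b F F ⟨
      ∑⁴ b (λ w x y z → F w x y z + F w x y z)
        ≡⟨ ∑⁴-cong b (wlog-sorted (λ w x y z → F w x y z + F w x y z ≡ permutations w x y z)
             (λ {w} {x} {y} {z} eq → subst₂ (λ f p → f + f ≡ p) (F₁₂ w x y z) (permutations-swap₁₂ w x y z) eq)
             (λ {w} {x} {y} {z} eq → subst₂ (λ f p → f + f ≡ p) (F₂₃ w x y z) (permutations-swap₂₃ w x y z) eq)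
             (λ {w} {x} {y} {z} eq → subst₂ (λ f p → f + f ≡ p) (F₃₄ w x y z) (permutations-swap₃₄ w x y z) eq)
             (λ {w} {x} {y} {z} z≤y y≤x x≤w → trans (cong (λ f → f + f) (F-sorted z≤y y≤x x≤w))
                (trans (cong (g (w ∸ z) (x ∸ y) +_) (sym (+-identityʳ _))) (sym (permutations-sorted z≤y y≤x x≤w))))) ⟩
      ∑⁴ b permutations           ≡⟨ ∑⁴-permutations ⟩
      24 * ∑⁴ b nested            ≡⟨ cong (24 *_) ∑⁴-nested ⟩
      24 * (2 * T)                ≡⟨ x*2y T ⟩
      2 * (24 * T)                ∎)
      where
      open ≡-Reasoning
      T = ∑[ D < b ] ((b ∸ D) * ∑[ E < b ] ((D ∸ E) * g D E))
      x*2y : ∀ y → 24 * (2 * y) ≡ 2 * (24 * y)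
      x*2y = solve-∀

-- The weighted number of admissible pairs

∑-split : ∀ m n (f : ℕ → ℕ) → ∑< (m + n) f ≡ ∑< m f + ∑[ i < n ] f (m + i)
∑-split zero    n f = refl
∑-split (suc m) n f = trans (cong (f 0 +_) (∑-split m n (f ∘ suc))) (sym (+-assoc (f 0) _ _))

∑-last : ∀ n (f : ℕ → ℕ) → ∑< (suc n) f ≡ ∑< n f + f n
∑-last zero    f = +-identityʳ (f 0)
∑-last (suc n) f = trans (cong (f 0 +_) (∑-last n (f ∘ suc))) (sym (+-assoc (f 0) _ _))

∑-multiples : ∀ m .{{_ : NonZero m}} n (f : ℕ → ℕ) → (∀ x → ¬ m ∣ x → f x ≡ 0) →
              ∑< (n * m) f ≡ ∑[ i < n ] f (i * m)
∑-multiples m zero    f off = refl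
∑-multiples (suc m) (suc n) f off = begin
  ∑< (suc m + n * suc m) f
    ≡⟨ ∑-split (suc m) (n * suc m) f ⟩
  f 0 + ∑< m (f ∘ suc) + ∑[ x < n * suc m ] f (suc m + x)
    ≡⟨ cong₂ (λ u v → f 0 + u + v) tail
         (∑-multiples (suc m) n (λ x → f (suc m + x)) (λ x m∤x → off (suc m + x) (λ m∣ → m∤x (∣m+n∣m⇒∣n m∣ ∣-refl)))) ⟩
  f 0 + 0 + ∑[ i < n ] f (suc m + i * suc m)
    ≡⟨ cong (_+ ∑[ i < n ] f (suc i * suc m)) (+-identityʳ (f 0)) ⟩
  f 0 + ∑[ i < n ] f (suc i * suc m) ∎
  where
  open ≡-Reasoning
  tail : ∑< m (f ∘ suc) ≡ 0
  tail = trans (∑-cong< m (λ i i<m → off (suc i) (λ m∣ → <⇒≱ (s<s i<m) (∣⇒≤ m∣)))) (∑-zero m (λ _ → refl))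

-- Classes modulo 5 up to sign, because folding takes an absolute value. The classes `±1` and `±2`
-- have squares 1 and -1, hence the name `opposite` below.
data Residue : Set where
  0̄ ±1 ±2 : Residue

residue : ℕ → Residue
residue 0 = 0̄
residue 1 = ±1
residue 2 = ±2
residue 3 = ±2
residue 4 = ±1
residue (suc (suc (suc (suc (suc n))))) = residue n

opposite : Residue → Residue → Bool
opposite ±1 ±2 = true
opposite ±2 ±1 = true
opposite _  _  = false

χ : ℕ → ℕ → ℕ
χ i j = ⟦ opposite (residue i) (residue j) ⟧

residue-periodic : ∀ A r → residue (A * 5 + r) ≡ residue r
residue-periodic zero    r = refl
residue-periodic (suc A) r = residue-periodic A r

count : Residue → ℕ → ℕ
count α n = ∑[ j < n ] ⟦ opposite α (residue j) ⟧

-- Summing the counts up to `n` weights each `j` by n - j. This is how the linear weights are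
-- produced here; `prefix` and `volume` repeat the device for the outer index.
moment : Residue → ℕ → ℕ
moment α n = ∑[ t < n ] count α (n ∸ t)

count-0̄ : ∀ n → count 0̄ n ≡ 0
count-0̄ n = ∑-zero n (λ _ → refl)

moment-0̄ : ∀ n → moment 0̄ n ≡ 0
moment-0̄ n = ∑-zero n (λ t → count-0̄ (n ∸ t))

count⁵ : Residue → ℕ → ℕ
count⁵ α n = count α (5 + n) + (count α (4 + n) + (count α (3 + n) + (count α (2 + n) + count α (1 + n))))

count-step : ∀ α n → α ≢ 0̄ → count α (5 + n) ≡ 2 + count α n
count-step 0̄  n α≢0 = contradiction refl α≢0
count-step ±1 n α≢0 = refl
count-step ±2 n α≢0 = refl

count⁵-periodic : ∀ α A r → α ≢ 0̄ → count⁵ α (A * 5 + r) ≡ 10 * A + count⁵ α r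
count⁵-periodic α zero    r α≢0 = refl
count⁵-periodic α (suc A) r α≢0
  rewrite count-step α (5 + (A * 5 + r)) α≢0 | count-step α (4 + (A * 5 + r)) α≢0
        | count-step α (3 + (A * 5 + r)) α≢0 | count-step α (2 + (A * 5 + r)) α≢0
        | count-step α (1 + (A * 5 + r)) α≢0 =
  trans (lem₁ (count α (5 + (A * 5 + r))) (count α (4 + (A * 5 + r)))
              (count α (3 + (A * 5 + r))) (count α (2 + (A * 5 + r))) (count α (1 + (A * 5 + r))))
        (trans (cong (10 +_) (count⁵-periodic α A r α≢0)) (lem₂ A (count⁵ α r)))
  where
  lem₁ : ∀ a b c d e → 2 + a + (2 + b + (2 + c + (2 + d + (2 + e)))) ≡ 10 + (a + (b + (c + (d + e))))
  lem₁ = solve-∀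
  lem₂ : ∀ A n → 10 + (10 * A + n) ≡ 10 * (1 + A) + n
  lem₂ = solve-∀

-- Over one period `moment` grows by the five counts collected in `count⁵`. Each of them gains 2 per
-- period, as a nonzero class up to sign has two members, so the growth is linear in `A` and the
-- total is quadratic. The hypothesis on `count⁵ α r` is the initial value, to be checked by
-- evaluation for each concrete `r`.
moment-periodic : ∀ α A r → α ≢ 0̄ → count⁵ α r ≡ 5 + 2 * r →
                  moment α (A * 5 + r) ≡ 5 * A * A + 2 * r * A + moment α r
moment-periodic α zero    r α≢0 eq = sym (cong (_+ moment α r) (*-zeroʳ (2 * r)))
moment-periodic α (suc A) r α≢0 eq = begin
  moment α (5 + (A * 5 + r))
    ≡⟨ lem₁ (count α (5 + (A * 5 + r))) (count α (4 + (A * 5 + r)))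
            (count α (3 + (A * 5 + r))) (count α (2 + (A * 5 + r))) (count α (1 + (A * 5 + r))) _ ⟩
  count⁵ α (A * 5 + r) + moment α (A * 5 + r)
    ≡⟨ cong₂ _+_ (trans (count⁵-periodic α A r α≢0) (cong (10 * A +_) eq)) (moment-periodic α A r α≢0 eq) ⟩
  10 * A + (5 + 2 * r) + (5 * A * A + 2 * r * A + moment α r)
    ≡⟨ lem₂ A r (moment α r) ⟩
  5 * suc A * suc A + 2 * r * suc A + moment α r ∎
  where
  open ≡-Reasoning
  lem₁ : ∀ a b c d e f → a + (b + (c + (d + (e + f)))) ≡ (a + (b + (c + (d + e)))) + f
  lem₁ = solve-∀
  lem₂ : ∀ A r c → 10 * A + (5 + 2 * r) + (5 * A * A + 2 * r * A + c) ≡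
                   5 * (1 + A) * (1 + A) + 2 * r * (1 + A) + c
  lem₂ = solve-∀

column : ℕ → ℕ
column i = moment (residue i) i

column-periodic : ∀ A r → residue r ≢ 0̄ → count⁵ (residue r) r ≡ 5 + 2 * r →
                  column (r + A * 5) ≡ 5 * A * A + 2 * r * A + column r
column-periodic A r r≢0 eq rewrite +-comm r (A * 5) | residue-periodic A r =
  moment-periodic (residue r) A r r≢0 eq

column-0 : ∀ A → column (A * 5) ≡ 0
column-0 A rewrite sym (+-identityʳ (A * 5)) | residue-periodic A 0 = moment-0̄ (A * 5 + 0)

prefix : ℕ → ℕ
prefix n = ∑< n column

volume : ℕ → ℕ
volume n = ∑[ p < n ] prefix (n ∸ p)

prefix-1 : ∀ A → prefix (1 + A * 5) ≡ prefix (A * 5)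
prefix-1 A = trans (∑-last (A * 5) column) (trans (cong (prefix (A * 5) +_) (column-0 A)) (+-identityʳ _))

prefix-suc : ∀ A r → residue r ≢ 0̄ → count⁵ (residue r) r ≡ 5 + 2 * r →
             prefix (suc r + A * 5) ≡ prefix (r + A * 5) + (5 * A * A + 2 * r * A + column r)
prefix-suc A r r≢0 eq = trans (∑-last (r + A * 5) column) (cong (prefix (r + A * 5) +_) (column-periodic A r r≢0 eq))

module _ (A : ℕ) where
  private
    P = prefix (A * 5)
  -- In this and the next three equations the constants 0, 1, 2, 3 are the values of `column` at 1,
  -- 2, 3, 4. Columns at multiples of 5 vanish.
  prefix-2 : prefix (2 + A * 5) ≡ P + (5 * A * A + 2 * A)
  prefix-2 = trans (prefix-suc A 1 (λ ()) refl) (cong₂ _+_ (prefix-1 A) (+-identityʳ _))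
  prefix-3 : prefix (3 + A * 5) ≡ P + (5 * A * A + 2 * A) + (5 * A * A + 4 * A + 1)
  prefix-3 = trans (prefix-suc A 2 (λ ()) refl) (cong (_+ (5 * A * A + 4 * A + 1)) prefix-2)
  prefix-4 : prefix (4 + A * 5) ≡ P + (5 * A * A + 2 * A) + (5 * A * A + 4 * A + 1) + (5 * A * A + 6 * A + 2)
  prefix-4 = trans (prefix-suc A 3 (λ ()) refl) (cong (_+ (5 * A * A + 6 * A + 2)) prefix-3)
  prefix-5 : prefix (5 + A * 5) ≡ P + (5 * A * A + 2 * A) + (5 * A * A + 4 * A + 1) + (5 * A * A + 6 * A + 2) + (5 * A * A + 8 * A + 3)
  prefix-5 = trans (prefix-suc A 4 (λ ()) refl) (cong (_+ (5 * A * A + 8 * A + 3)) prefix-4)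

-- Three times the columns of one period add up to 60 A² + 60 A + 18, which is 2 less than the
-- increment of 20 A³. The term `2 * A` makes up for this without a subtraction.
prefix-closed : ∀ A → 3 * prefix (A * 5) + 2 * A ≡ 20 * A * A * A
prefix-closed zero    = refl
prefix-closed (suc A) = trans (cong (λ p → 3 * p + 2 * suc A) (prefix-5 A)) (
  trans (lem₁ (prefix (A * 5)) A) (trans (cong (_+ (60 * A * A + 60 * A + 20)) (prefix-closed A)) (lem₂ A)))
  where
  lem₁ : ∀ P A → 3 * (P + (5 * A * A + 2 * A) + (5 * A * A + 4 * A + 1) + (5 * A * A + 6 * A + 2) + (5 * A * A + 8 * A + 3)) + 2 * (1 + A)
         ≡ 3 * P + 2 * A + (60 * A * A + 60 * A + 20)
  lem₁ = solve-∀
  lem₂ : ∀ A → 20 * A * A * A + (60 * A * A + 60 * A + 20) ≡ 20 * (1 + A) * (1 + A) * (1 + A)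
  lem₂ = solve-∀

volume-closed : ∀ A → 3 * volume (A * 5) ≡ 5 * A * A + 25 * A * A * A * A
volume-closed zero    = refl
-- The new period contributes five prefixes, each containing `prefix (A * 5)`; adding `10 * A`
-- supplies the `2 * A` that each needs for `prefix-closed`.
volume-closed (suc A) = +-cancelʳ-≡ (10 * A) _ _ (begin
  3 * volume (5 + A * 5) + 10 * A
    ≡⟨ cong (λ s → 3 * s + 10 * A) (cong₂ _+_ (prefix-5 A) (cong₂ _+_ (prefix-4 A)
         (cong₂ _+_ (prefix-3 A) (cong₂ _+_ (prefix-2 A) (cong (_+ volume (A * 5)) (prefix-1 A)))))) ⟩
  _ ≡⟨ lem₁ (prefix (A * 5)) (volume (A * 5)) A ⟩
  5 * (3 * prefix (A * 5) + 2 * A) + 3 * volume (A * 5) + (150 * A * A + 120 * A + 30)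
    ≡⟨ cong₂ (λ p v → 5 * p + v + (150 * A * A + 120 * A + 30)) (prefix-closed A) (volume-closed A) ⟩
  5 * (20 * A * A * A) + (5 * A * A + 25 * A * A * A * A) + (150 * A * A + 120 * A + 30)
    ≡⟨ lem₂ A ⟩
  5 * suc A * suc A + 25 * suc A * suc A * suc A * suc A + 10 * A ∎)
  where
  open ≡-Reasoning
  lem₁ : ∀ P V A →
    3 * (P + (5 * A * A + 2 * A) + (5 * A * A + 4 * A + 1) + (5 * A * A + 6 * A + 2) + (5 * A * A + 8 * A + 3) +
        (P + (5 * A * A + 2 * A) + (5 * A * A + 4 * A + 1) + (5 * A * A + 6 * A + 2) +
        (P + (5 * A * A + 2 * A) + (5 * A * A + 4 * A + 1) +
        (P + (5 * A * A + 2 * A) + (P + V))))) + 10 * A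
    ≡ 5 * (3 * P + 2 * A) + 3 * V + (150 * A * A + 120 * A + 30)
  lem₁ = solve-∀
  lem₂ : ∀ A → 5 * (20 * A * A * A) + (5 * A * A + 25 * A * A * A * A) + (150 * A * A + 120 * A + 30)
    ≡ 5 * (1 + A) * (1 + A) + 25 * (1 + A) * (1 + A) * (1 + A) * (1 + A) + 10 * A
  lem₂ = solve-∀

∑-column : ∀ {i n} → i ≤ n → ∑[ j < n ] ((i ∸ j) * χ i j) ≡ column i
∑-column {i} i≤n = sym (∑-triangle i ≤-refl i≤n (χ i))

∑-volume : ∀ n → ∑[ i < n ] ((n ∸ i) * ∑[ j < n ] ((i ∸ j) * χ i j)) ≡ volume n
∑-volume n = trans (∑-cong< n (λ i i<n → cong ((n ∸ i) *_) (∑-column (<⇒≤ i<n))))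
                   (sym (∑-triangle n ≤-refl ≤-refl column))

-- On multiples of `m` both weights are homogeneous: b - D and D - E release one factor `m` each.
∑-lattice : ∀ m .{{_ : NonZero m}} n (g : ℕ → ℕ → ℕ) →
            (∀ D E → ¬ m ∣ D → g D E ≡ 0) → (∀ D E → ¬ m ∣ E → g D E ≡ 0) →
            (∀ i j → g (i * m) (j * m) ≡ χ i j) →
            ∑[ D < n * m ] ((n * m ∸ D) * ∑[ E < n * m ] ((D ∸ E) * g D E)) ≡ m * m * volume n
∑-lattice m n g offˡ offʳ on = begin
  ∑[ D < n * m ] ((n * m ∸ D) * ∑[ E < n * m ] ((D ∸ E) * g D E))
    ≡⟨ ∑-multiples m n _ (λ D m∤D → trans (cong ((n * m ∸ D) *_) (∑-zero (n * m)
         (λ E → trans (cong ((D ∸ E) *_) (offˡ D E m∤D)) (*-zeroʳ (D ∸ E))))) (*-zeroʳ (n * m ∸ D))) ⟩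
  ∑[ i < n ] ((n * m ∸ i * m) * ∑[ E < n * m ] ((i * m ∸ E) * g (i * m) E))
    ≡⟨ ∑-cong n row ⟩
  ∑[ i < n ] (m * m * ((n ∸ i) * ∑[ j < n ] ((i ∸ j) * χ i j)))
    ≡⟨ ∑-*ˡ n (m * m) _ ⟩
  m * m * ∑[ i < n ] ((n ∸ i) * ∑[ j < n ] ((i ∸ j) * χ i j))
    ≡⟨ cong (m * m *_) (∑-volume n) ⟩
  m * m * volume n ∎
  where
  open ≡-Reasoning
  lem : ∀ a m s → a * m * (m * s) ≡ m * m * (a * s)
  lem = solve-∀
  cell : ∀ a m s → a * m * s ≡ m * (a * s)
  cell = solve-∀
  row : ∀ i → (n * m ∸ i * m) * ∑[ E < n * m ] ((i * m ∸ E) * g (i * m) E) ≡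
              m * m * ((n ∸ i) * ∑[ j < n ] ((i ∸ j) * χ i j))
  row i = begin
    (n * m ∸ i * m) * ∑[ E < n * m ] ((i * m ∸ E) * g (i * m) E)
      ≡⟨ cong₂ _*_ (sym (*-distribʳ-∸ m n i))
           (∑-multiples m n _ (λ E m∤E → trans (cong ((i * m ∸ E) *_) (offʳ (i * m) E m∤E)) (*-zeroʳ (i * m ∸ E)))) ⟩
    (n ∸ i) * m * ∑[ j < n ] ((i * m ∸ j * m) * g (i * m) (j * m))
      ≡⟨ cong ((n ∸ i) * m *_) (trans (∑-cong n (λ j → trans (cong₂ _*_ (sym (*-distribʳ-∸ m i j)) (on i j))
           (cell (i ∸ j) m (χ i j)))) (∑-*ˡ n m _)) ⟩
    (n ∸ i) * m * (m * ∑[ j < n ] ((i ∸ j) * χ i j))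
      ≡⟨ lem (n ∸ i) m _ ⟩
    m * m * ((n ∸ i) * ∑[ j < n ] ((i ∸ j) * χ i j)) ∎

-- Digits and the Kaprekar map

sort-unique : ∀ {xs ys} → xs ↭ ys → Sorted ys → sort xs ≡ ys
sort-unique {xs} {ys} xs↭ys ys↗ = Pointwise-≡⇒≡
  (↗↭↗⇒≋ ≤-totalOrder (sort-↗ xs) ys↗ (↭⇒↭ₛ (↭-trans (sort-↭ xs) xs↭ys)))

sort-cong : ∀ {xs ys} → xs ↭ ys → sort xs ≡ sort ys
sort-cong {xs} {ys} xs↭ys = sort-unique (↭-trans xs↭ys (↭-sym (sort-↭ ys))) (sort-↗ ys)

gaps : List ℕ → ℕ × ℕ
gaps (s ∷ r ∷ q ∷ p ∷ []) = p ∸ s , q ∸ r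
gaps _                    = 0 , 0

spread : ℕ → ℕ → ℕ → ℕ → ℕ × ℕ
spread w x y z = gaps (sort (w ∷ x ∷ y ∷ z ∷ []))

spread-swap₁₂ : ∀ w x y z → spread w x y z ≡ spread x w y z
spread-swap₁₂ w x y z = cong gaps (sort-cong (↭.swap w x (↭.refl {xs = y ∷ z ∷ []})))

spread-swap₂₃ : ∀ w x y z → spread w x y z ≡ spread w y x z
spread-swap₂₃ w x y z = cong gaps (sort-cong (↭.prep w (↭.swap x y (↭.refl {xs = z ∷ []}))))

spread-swap₃₄ : ∀ w x y z → spread w x y z ≡ spread w x z y
spread-swap₃₄ w x y z = cong gaps (sort-cong (↭.prep w (↭.prep x (↭.swap y z (↭.refl {xs = []})))))

spread-ascending : ∀ {s r q p} → s ≤ r → r ≤ q → q ≤ p → spread s r q p ≡ (p ∸ s , q ∸ r)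
spread-ascending s≤r r≤q q≤p = cong gaps (sort-unique ↭.refl (s≤r ∷ r≤q ∷ q≤p ∷ [-]))

spread-descending : ∀ {w x y z} → z ≤ y → y ≤ x → x ≤ w → spread w x y z ≡ (w ∸ z , x ∸ y)
spread-descending {w} {x} {y} {z} z≤y y≤x x≤w = begin
  spread w x y z ≡⟨ spread-swap₁₂ w x y z ⟩
  spread x w y z ≡⟨ spread-swap₂₃ x w y z ⟩
  spread x y w z ≡⟨ spread-swap₁₂ x y w z ⟩
  spread y x w z ≡⟨ spread-swap₃₄ y x w z ⟩
  spread y x z w ≡⟨ spread-swap₂₃ y x z w ⟩
  spread y z x w ≡⟨ spread-swap₁₂ y z x w ⟩
  spread z y x w ≡⟨ spread-ascending z≤y y≤x x≤w ⟩
  (w ∸ z , x ∸ y) ∎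
  where open ≡-Reasoning

-- The gaps of two intervals of widths `u` and `v` whose centres differ by 1. Equal widths give the
-- sorted values l, l + 1, l + u, l + u + 1 and hence `tied`; the absolute value covers `u = 0`,
-- where both gaps are 1.
data Folded (u v : ℕ) : ℕ × ℕ → Set where
  outer : v < u → Folded u v (u , v)
  inner : u < v → Folded u v (v , u)
  tied  : u ≡ v → Folded u v (suc u , ∣ u - 1 ∣)

-- The hypothesis says that the sums of the two pairs differ by 2, so `u` and `v` have equal parity,
-- and unequal widths differ by at least 2, which outweighs the shift of the centres. Comparing left
-- ends decides the case: l ≤ l′, l = l′ + 1 and l ≥ l′ + 2 mean u > v, u = v and u < v.
folded-spread : ∀ {l u l′ v} → 2 * l + u ≡ 2 + (2 * l′ + v) →
                Folded u v (spread l (l + u) l′ (l′ + v))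
folded-spread {l} {u} {l′} {v} eq with <-≤-connex l′ l
... | inj₂ l≤l′ with m≤n⇒∃[o]m+o≡n l≤l′
...   | k , refl = subst (Folded u v) (sym spread≡) (outer (≤-trans (s≤s (m≤n+m v (1 + 2 * k))) (≤-reflexive (sym u≡))))
  where
  open ≡-Reasoning
  arith : ∀ l k v → 2 + (2 * (l + k) + v) ≡ 2 * l + (2 + 2 * k + v)
  arith = solve-∀
  u≡ : u ≡ 2 + 2 * k + v
  u≡ = +-cancelˡ-≡ (2 * l) _ _ (trans eq (arith l k v))
  hi : ∀ l k v → l + (2 + 2 * k + v) ≡ (l + k + v) + (2 + k)
  hi = solve-∀
  hi≤ : l + k + v ≤ l + u
  hi≤ = ≤-trans (m≤m+n _ (2 + k)) (≤-reflexive (trans (sym (hi l k v)) (cong (l +_) (sym u≡))))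
  spread≡ : spread l (l + u) (l + k) (l + k + v) ≡ (u , v)
  spread≡ = begin
    spread l (l + u) (l + k) (l + k + v) ≡⟨ spread-swap₂₃ l (l + u) (l + k) (l + k + v) ⟩
    spread l (l + k) (l + u) (l + k + v) ≡⟨ spread-swap₃₄ l (l + k) (l + u) (l + k + v) ⟩
    spread l (l + k) (l + k + v) (l + u) ≡⟨ spread-ascending (m≤m+n l k) (m≤m+n (l + k) v) hi≤ ⟩
    (l + u ∸ l , l + k + v ∸ (l + k))    ≡⟨ cong₂ _,_ (m+n∸m≡n l u) (m+n∸m≡n (l + k) v) ⟩
    (u , v) ∎
folded-spread {l} {u} {l′} {v} eq | inj₁ l′<l with m<n⇒∃[o]o+1+m≡n l′<l
... | zero , refl = subst (λ w → Folded u w (spread (suc l′) (suc l′ + u) l′ (l′ + w))) u≡v (subst (Folded u u) (sym (spread≡ u)) (tied refl))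
  where
  open ≡-Reasoning
  arith : ∀ l u → 2 * (1 + l) + u ≡ 2 + 2 * l + u
  arith = solve-∀
  u≡v : u ≡ v
  u≡v = +-cancelˡ-≡ (2 + 2 * l′) _ _ (trans (sym (arith l′ u)) eq)
  spread≡ : ∀ u → spread (suc l′) (suc l′ + u) l′ (l′ + u) ≡ (suc u , ∣ u - 1 ∣)
  spread≡ u = begin
    spread (suc l′) (suc l′ + u) l′ (l′ + u)   ≡⟨ spread-swap₂₃ (suc l′) (suc l′ + u) l′ (l′ + u) ⟩
    spread (suc l′) l′ (suc l′ + u) (l′ + u)   ≡⟨ spread-swap₁₂ (suc l′) l′ (suc l′ + u) (l′ + u) ⟩
    spread l′ (suc l′) (suc l′ + u) (l′ + u)   ≡⟨ spread-swap₃₄ l′ (suc l′) (suc l′ + u) (l′ + u) ⟩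
    spread l′ (suc l′) (l′ + u) (suc l′ + u)   ≡⟨ middle u ⟩
    (suc u , ∣ u - 1 ∣) ∎
    where
    width : ∀ u → suc l′ + u ∸ l′ ≡ suc u
    width u = trans (cong (_∸ l′) (sym (+-suc l′ u))) (m+n∸m≡n l′ (suc u))
    middle : ∀ u → spread l′ (suc l′) (l′ + u) (suc l′ + u) ≡ (suc u , ∣ u - 1 ∣)
    -- For width 0 each pair is a repeated digit, so `suc l′` and `l′ + 0` change places in the
    -- sorted order.
    middle zero    = begin
      spread l′ (suc l′) (l′ + 0) (suc l′ + 0) ≡⟨ spread-swap₂₃ l′ (suc l′) (l′ + 0) (suc l′ + 0) ⟩
      spread l′ (l′ + 0) (suc l′) (suc l′ + 0) ≡⟨ spread-ascending (m≤m+n l′ 0)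
        (≤-trans (≤-reflexive (+-identityʳ l′)) (n≤1+n l′)) (m≤m+n (suc l′) 0) ⟩
      (suc l′ + 0 ∸ l′ , suc l′ ∸ (l′ + 0))    ≡⟨ cong₂ _,_ (width 0) (trans (cong (suc l′ ∸_) (+-identityʳ l′)) (m+n∸n≡m 1 l′)) ⟩
      (1 , 1) ∎
    middle (suc u) = begin
      spread l′ (suc l′) (l′ + suc u) (suc l′ + suc u) ≡⟨ spread-ascending (n≤1+n l′)
        (≤-trans (m≤m+n (suc l′) u) (≤-reflexive (sym (+-suc l′ u)))) (n≤1+n _) ⟩
      (suc l′ + suc u ∸ l′ , l′ + suc u ∸ suc l′)      ≡⟨ cong₂ _,_ (width (suc u))
        (trans (cong (_∸ suc l′) (+-suc l′ u)) (trans (m+n∸m≡n l′ u) (sym (∣n-0∣≡n u)))) ⟩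
      (suc (suc u) , ∣ u - 0 ∣) ∎
      where
      ∣n-0∣≡n : ∀ n → ∣ n - 0 ∣ ≡ n
      ∣n-0∣≡n = ∣-∣-identityʳ
... | suc k , refl = subst (Folded u v) (sym spread≡) (inner (≤-trans (s≤s (m≤n+m u (1 + 2 * k))) (≤-reflexive v≡)))
  where
  open ≡-Reasoning
  arith : ∀ k l u → 2 * (2 + k + l) + u ≡ 2 + (2 * l + (2 + 2 * k + u))
  arith = solve-∀
  v≡ : 2 + 2 * k + u ≡ v
  v≡ = +-cancelˡ-≡ (2 + 2 * l′) _ _ (trans (sym (arith k l′ u)) eq)
  hi : ∀ k l u → l + (2 + 2 * k + u) ≡ (2 + k + l + u) + k
  hi = solve-∀
  hi≤ : l + u ≤ l′ + v
  hi≤ = ≤-trans (m≤m+n _ k) (≤-reflexive (trans (sym (hi k l′ u)) (cong (l′ +_) v≡)))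
  spread≡ : spread l (l + u) l′ (l′ + v) ≡ (v , u)
  spread≡ = begin
    spread l (l + u) l′ (l′ + v) ≡⟨ spread-swap₂₃ l (l + u) l′ (l′ + v) ⟩
    spread l l′ (l + u) (l′ + v) ≡⟨ spread-swap₁₂ l l′ (l + u) (l′ + v) ⟩
    spread l′ l (l + u) (l′ + v) ≡⟨ spread-ascending (m≤n+m l′ (suc (suc k))) (m≤m+n l u) hi≤ ⟩
    (l′ + v ∸ l′ , l + u ∸ l)    ≡⟨ cong₂ _,_ (m+n∸m≡n l′ v) (m+n∸m≡n l u) ⟩
    (v , u) ∎

-- u = |2x − b|.
data Fold (b x u : ℕ) : Set where
  below : 2 * x + u ≡ b → Fold b x u
  above : 2 * x ≡ b + u → Fold b x u

-- The four digits of D·b³ + E·b² − E·b − D for E = 1 + e > 0, where D + h = b and e + f + 2 = b.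
spread-steep : ∀ {b D h e f} → D + h ≡ b → e + f + 2 ≡ b →
               ∃₂ λ u v → Fold b D u × Fold b (suc e) v × Folded u v (spread D e f h)
spread-steep {b} {D} {h} {e} {f} D+h≡b e+f+2≡b =
  map₂ (map₂ (map₂ (map₂ (subst (Folded _ _) (sym (reorder D e f h)))))) (pair₁ (≤-total D h) (≤-total e f))
  where
  open ≡-Reasoning
  reorder : ∀ D e f h → spread D e f h ≡ spread D h e f
  reorder D e f h = trans (spread-swap₃₄ D e f h) (spread-swap₂₃ D e h f)
  2l+u≡b : ∀ l u → l + (l + u) ≡ 2 * l + u
  2l+u≡b = solve-∀
  2h≡ : ∀ l u → 2 * (l + u) ≡ l + (l + u) + u
  2h≡ = solve-∀
  2l+v≡b : ∀ l v → l + (l + v) + 2 ≡ 2 + (2 * l + v)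
  2l+v≡b = solve-∀
  2+2l+v≡b : ∀ l v → 2 * suc l + v ≡ l + (l + v) + 2
  2+2l+v≡b = solve-∀
  2+2h≡ : ∀ l v → 2 * suc (l + v) ≡ l + (l + v) + 2 + v
  2+2h≡ = solve-∀
  pair₂ : ∀ l u e f → 2 * l + u ≡ b → e + f + 2 ≡ b → e ≤ f ⊎ f ≤ e →
          ∃[ v ] Fold b (suc e) v × Folded u v (spread l (l + u) e f)
  pair₂ l u e f eq e+f≡b (inj₁ e≤f) with m≤n⇒∃[o]m+o≡n e≤f
  ... | v , refl = v , below (trans (2+2l+v≡b e v) e+f≡b)
                 , folded-spread {l} {u} {e} {v} (trans eq (trans (sym e+f≡b) (2l+v≡b e v)))
  pair₂ l u e f eq e+f≡b (inj₂ f≤e) with m≤n⇒∃[o]m+o≡n f≤e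
  ... | v , refl = v , above (trans (2+2h≡ f v) (cong (_+ v) f+e≡b))
                 , subst (Folded u v) (sym (spread-swap₃₄ l (l + u) (f + v) f))
                     (folded-spread {l} {u} {f} {v} (trans eq (trans (sym f+e≡b) (2l+v≡b f v))))
    where
    f+e≡b : f + (f + v) + 2 ≡ b
    f+e≡b = trans (cong (_+ 2) (+-comm f (f + v))) e+f≡b
  pair₁ : D ≤ h ⊎ h ≤ D → e ≤ f ⊎ f ≤ e → ∃₂ λ u v → Fold b D u × Fold b (suc e) v × Folded u v (spread D h e f)
  pair₁ (inj₁ D≤h) e≶f with m≤n⇒∃[o]m+o≡n D≤h
  ... | u , refl with pair₂ D u e f (trans (sym (2l+u≡b D u)) D+h≡b) e+f+2≡b e≶f
  ...   | v , fold , folded = u , v , below (trans (sym (2l+u≡b D u)) D+h≡b) , fold , folded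
  pair₁ (inj₂ h≤D) e≶f with m≤n⇒∃[o]m+o≡n h≤D
  ... | u , refl with pair₂ h u e f (trans (sym (2l+u≡b h u)) h+D≡b) e+f+2≡b e≶f
    where
    h+D≡b : h + (h + u) ≡ b
    h+D≡b = trans (+-comm h (h + u)) D+h≡b
  ...   | v , fold , folded = u , v , above (trans (2h≡ h u) (cong (_+ u) (trans (+-comm h (h + u)) D+h≡b))) , fold
                            , subst (Folded u v) (spread-swap₁₂ h (h + u) e f) folded

-- The Kaprekar map as a transition between pairs of gaps

module _ (b : ℕ) where

  spreadOf : FourDigit b → ℕ × ℕ
  spreadOf x = gaps (sort (map toℕ (digits b x)))

  number : (w x y z : Fin b) → FourDigit b
  number w x y z = funToFin {4} λ { 0F → w ; 1F → x ; 2F → y ; 3F → z }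

  digits-number : ∀ w x y z → digits b (number w x y z) ≡ w ∷ x ∷ y ∷ z ∷ []
  digits-number w x y z = tabulate-cong (finToFun-funToFin {4} {b} λ { 0F → w ; 1F → x ; 2F → y ; 3F → z })

  toℕ-number : ∀ w x y z → toℕ (number w x y z) ≡ fromDigits (z ∷ y ∷ x ∷ w ∷ [])
  toℕ-number w x y z = trans (sym (fromDigits-digits b (number w x y z))) (cong (fromDigits ∘ reverse) (digits-number w x y z))

  spreadOf-number : ∀ w x y z → spreadOf (number w x y z) ≡ spread (toℕ w) (toℕ x) (toℕ y) (toℕ z)
  spreadOf-number w x y z = cong (gaps ∘ sort ∘ map toℕ) (digits-number w x y z)

  spreadOf-value : ∀ {w x y z} → w < b → x < b → y < b → z < b → ∀ n →
                   toℕ n ≡ z + (y + (x + w * b) * b) * b → spreadOf n ≡ spread w x y z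
  spreadOf-value {w} {x} {y} {z} w<b x<b y<b z<b n eq = begin
    spreadOf n ≡⟨ cong spreadOf (toℕ-injective (trans eq (sym value))) ⟩
    spreadOf m ≡⟨ spreadOf-number _ _ _ _ ⟩
    spread (toℕ (fromℕ< w<b)) (toℕ (fromℕ< x<b)) (toℕ (fromℕ< y<b)) (toℕ (fromℕ< z<b))
      ≡⟨ digit ⟩
    spread w x y z ∎
    where
    open ≡-Reasoning
    m = number (fromℕ< w<b) (fromℕ< x<b) (fromℕ< y<b) (fromℕ< z<b)
    digit : spread (toℕ (fromℕ< w<b)) (toℕ (fromℕ< x<b)) (toℕ (fromℕ< y<b)) (toℕ (fromℕ< z<b)) ≡ spread w x y z
    digit rewrite toℕ-fromℕ< w<b | toℕ-fromℕ< x<b | toℕ-fromℕ< y<b | toℕ-fromℕ< z<b = refl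
    arith : ∀ w → z + (y + (x + (w + 0 * b) * b) * b) * b ≡ z + (y + (x + w * b) * b) * b
    arith w = cong (λ w → z + (y + (x + w * b) * b) * b) (+-identityʳ w)
    value : toℕ m ≡ z + (y + (x + w * b) * b) * b
    value rewrite toℕ-number (fromℕ< w<b) (fromℕ< x<b) (fromℕ< y<b) (fromℕ< z<b)
                | toℕ-fromℕ< w<b | toℕ-fromℕ< x<b | toℕ-fromℕ< y<b | toℕ-fromℕ< z<b = arith w

  module FinSort = InsertionSort (Fin.≤-decTotalOrder b)

  sort-toℕ : ∀ (xs : List (Fin b)) → map toℕ (FinSort.sort xs) ≡ sort (map toℕ xs)
  sort-toℕ []       = refl
  sort-toℕ (x ∷ xs) = trans (insert-toℕ x (FinSort.sort xs)) (cong (insert (toℕ x)) (sort-toℕ xs))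
    where
    insert-toℕ : ∀ x xs → map toℕ (FinSort.insert x xs) ≡ insert (toℕ x) (map toℕ xs)
    insert-toℕ x []       = refl
    insert-toℕ x (y ∷ xs) with does (toℕ x ≤? toℕ y)
    ... | true  = refl
    ... | false = cong (toℕ y ∷_) (insert-toℕ x xs)

  difference : ∀ (xs : List (Fin b)) → length xs ≡ 4 → Sorted (map toℕ xs) →
    let (D , E) = gaps (map toℕ xs) in
    E ≤ D × D < b × fromDigits xs ∸ fromDigits (reverse xs) + (D + E * b) ≡ D * b ^ 3 + E * b ^ 2
  difference (s ∷ r ∷ q ∷ p ∷ []) refl (s≤r ∷ r≤q ∷ q≤p ∷ [-]) =
    ∸-mono q≤p s≤r ,
    ≤-<-trans (m∸n≤m (toℕ p) (toℕ s)) (toℕ<n p) ,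
    lem b (toℕ<n p) (≤-trans s≤r (≤-trans r≤q q≤p)) r≤q
    where
    -- With `b = suc c` the coefficients b³ - 1 and b² - b of D and E become polynomials in `c`
    -- without subtraction.
    arith : ∀ c s r D E →
      s + (r + (r + E + (s + D + 0 * suc c) * suc c) * suc c) * suc c
      ≡ s + D + (r + E + (r + (s + 0 * suc c) * suc c) * suc c) * suc c + (D * (c * c * c + 3 * c * c + 3 * c) + E * (c * c + c))
    arith = solve-∀
    arith′ : ∀ c D E → D * (c * c * c + 3 * c * c + 3 * c) + E * (c * c + c) + (D + E * suc c)
      ≡ D * (suc c * (suc c * (suc c * 1))) + E * (suc c * (suc c * 1))
    arith′ = solve-∀
    lem : ∀ b {s r q p} → p < b → s ≤ p → r ≤ q →
      s + (r + (q + (p + 0 * b) * b) * b) * b ∸ (p + (q + (r + (s + 0 * b) * b) * b) * b) + (p ∸ s + (q ∸ r) * b)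
        ≡ (p ∸ s) * b ^ 3 + (q ∸ r) * b ^ 2
    lem (suc c) {s} {r} p<b s≤p r≤q with m≤n⇒∃[o]m+o≡n s≤p | m≤n⇒∃[o]m+o≡n r≤q
    ... | D , refl | E , refl
      rewrite m+n∸m≡n s D | m+n∸m≡n r E = trans (cong (_+ (D + E * suc c))
        (trans (cong (_∸ (s + D + (r + E + (r + (s + 0 * suc c) * suc c) * suc c) * suc c)) (arith c s r D E))
               (m+n∸m≡n (s + D + (r + E + (r + (s + 0 * suc c) * suc c) * suc c) * suc c) _)))
        (arith′ c D E)

  spreadOf-sorted : ∀ x → spreadOf x ≡ gaps (map toℕ (FinSort.sort (digits b x)))
  spreadOf-sorted x = cong gaps (sym (sort-toℕ (digits b x)))

  K-value : ∀ x {D E} → spreadOf x ≡ (D , E) →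
            E ≤ D × D < b × toℕ (K b x) + (D + E * b) ≡ D * b ^ 3 + E * b ^ 2
  K-value x {D} {E} eq = subst₂ Difference toℕ-K (trans (sym (spreadOf-sorted x)) eq)
    (difference (FinSort.sort (digits b x)) length≡4
      (subst Sorted (sym (sort-toℕ (digits b x))) (sort-↗ (map toℕ (digits b x)))))
    where
    Difference : ℕ → ℕ × ℕ → Set
    Difference k (D , E) = E ≤ D × D < b × k + (D + E * b) ≡ D * b ^ 3 + E * b ^ 2
    toℕ-K : descending b x ∸ ascending b x ≡ toℕ (K b x)
    toℕ-K = sym (toℕ-fromℕ< (≤-<-trans (m∸n≤m (descending b x) (ascending b x)) (descending<b⁴ b x)))
    length≡4 : length (FinSort.sort (digits b x)) ≡ 4
    length≡4 = trans (sym (length-map toℕ (FinSort.sort (digits b x))))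
      (trans (cong length (sort-toℕ (digits b x)))
      (trans (↭-length (sort-↭ (map toℕ (digits b x)))) refl))

-- In the case `flat` the digits are D - 1, b - 1, b - 1, b - D. The outer two add up to b - 1, so
-- the new gaps are these same two numbers in decreasing order; only their sum and the possible
-- values of the larger one are recorded.
data Next (b : ℕ) : ℕ × ℕ → ℕ × ℕ → Set where
  zero  : Next b (0 , 0) (0 , 0)
  flat  : ∀ {D D′ E′} → suc (D′ + E′) ≡ b → suc D′ ≡ D ⊎ D′ + D ≡ b → Next b (D , 0) (D′ , E′)
  steep : ∀ {D e u v s} → Fold b D u → Fold b (suc e) v → Folded u v s → Next b (D , suc e) s

spread-flat : ∀ {b D h c} → suc D + h ≡ b → b ≡ suc c →
              ∃₂ λ D′ E′ → suc (D′ + E′) ≡ b × (suc D′ ≡ suc D ⊎ D′ + suc D ≡ b) × spread D c c h ≡ (D′ , E′)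
spread-flat {b} {D} {h} eq refl with refl ← suc-injective eq | ≤-total D h
... | inj₁ D≤h = h , D , cong suc (+-comm h D) , inj₂ (trans (+-suc h D) (cong suc (+-comm h D))) , (begin
  spread D (D + h) (D + h) h ≡⟨ spread-swap₃₄ D (D + h) (D + h) h ⟩
  spread D (D + h) h (D + h) ≡⟨ spread-swap₂₃ D (D + h) h (D + h) ⟩
  spread D h (D + h) (D + h) ≡⟨ spread-ascending D≤h (m≤n+m h D) ≤-refl ⟩
  (D + h ∸ D , D + h ∸ h)    ≡⟨ cong₂ _,_ (m+n∸m≡n D h) (m+n∸n≡m D h) ⟩
  (h , D) ∎)
  where open ≡-Reasoning
... | inj₂ h≤D = D , h , refl , inj₁ refl , (begin
  spread D (D + h) (D + h) h ≡⟨ spread-swap₃₄ D (D + h) (D + h) h ⟩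
  spread D (D + h) h (D + h) ≡⟨ spread-swap₂₃ D (D + h) h (D + h) ⟩
  spread D h (D + h) (D + h) ≡⟨ spread-swap₁₂ D h (D + h) (D + h) ⟩
  spread h D (D + h) (D + h) ≡⟨ spread-ascending h≤D (m≤m+n D h) ≤-refl ⟩
  (D + h ∸ h , D + h ∸ D)    ≡⟨ cong₂ _,_ (m+n∸n≡m D h) (m+n∸m≡n D h) ⟩
  (D , h) ∎)
  where open ≡-Reasoning

spreadOf-zero : ∀ b (x : FourDigit b) → toℕ x ≡ 0 → spreadOf b x ≡ (0 , 0)
spreadOf-zero zero    () eq
spreadOf-zero (suc c) x eq = spreadOf-value (suc c) z<s z<s z<s z<s x eq

K-zero : ∀ b x → spreadOf b x ≡ (0 , 0) → toℕ (K b x) ≡ 0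
K-zero b x eq = trans (sym (+-identityʳ _)) (proj₂ (proj₂ (K-value b x eq)))

K-cong : ∀ b x y → spreadOf b x ≡ spreadOf b y → K b x ≡ K b y
K-cong b x y eq = toℕ-injective (+-cancelʳ-≡ _ _ _
  (trans (proj₂ (proj₂ (K-value b x eq))) (sym (proj₂ (proj₂ (K-value b y refl))))))

-- The digits come from borrowing in D b³ + E b² - E b - D. They are verified as a long addition
-- instead: when D + E b is added back, each of the three low columns sums to `b`, including the
-- carry, and passes on a carry of 1.
next : ∀ b (k : FourDigit b) D E → E ≤ D → D < b → toℕ k + (D + E * b) ≡ D * b ^ 3 + E * b ^ 2 →
       Next b (D , E) (spreadOf b k)
next b k zero zero _ _ value = subst (Next b (0 , 0)) (sym (spreadOf-zero b k (trans (sym (+-identityʳ _)) value))) zero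
next b k (suc D) zero _ D<b value with h , refl ← m≤n⇒∃[o]m+o≡n (<⇒≤ D<b)
  with D′ , E′ , sum≡ , alt , spread≡ ← spread-flat {D = D} {h = h} refl refl =
  subst (Next b′ (suc D , 0)) (sym (trans spread-digits spread≡)) (flat sum≡ alt)
  where
  b′ = suc D + h
  arith : ∀ b D h c → suc D + h ≡ b → suc c ≡ b →
    h + (c + (c + D * b) * b) * b + (suc D + 0 * b) ≡ suc D * b ^ 3 + 0
  arith b D h c D+h≡b c≡b = begin
    h + (c + (c + D * b) * b) * b + (suc D + 0 * b)    ≡⟨ lem₁ b D h c ⟩
    (suc D + h) + (c + (c + D * b) * b) * b            ≡⟨ cong (_+ (c + (c + D * b) * b) * b) D+h≡b ⟩
    b + (c + (c + D * b) * b) * b                      ≡⟨ lem₂ b D c ⟩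
    (suc c + (c + D * b) * b) * b                      ≡⟨ cong (λ n → (n + (c + D * b) * b) * b) c≡b ⟩
    (b + (c + D * b) * b) * b                          ≡⟨ lem₃ b D c ⟩
    (suc c + D * b) * b * b                            ≡⟨ cong (λ n → (n + D * b) * b * b) c≡b ⟩
    (b + D * b) * b * b                                ≡⟨ lem₄ b D ⟩
    suc D * (b * (b * (b * 1))) + 0 ∎
    where
    open ≡-Reasoning
    lem₁ : ∀ b D h c → h + (c + (c + D * b) * b) * b + (suc D + 0 * b) ≡ (suc D + h) + (c + (c + D * b) * b) * b
    lem₁ = solve-∀
    lem₂ : ∀ b D c → b + (c + (c + D * b) * b) * b ≡ (suc c + (c + D * b) * b) * b
    lem₂ = solve-∀
    lem₃ : ∀ b D c → (b + (c + D * b) * b) * b ≡ (suc c + D * b) * b * b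
    lem₃ = solve-∀
    lem₄ : ∀ b D → (b + D * b) * b * b ≡ suc D * (b * (b * (b * 1))) + 0
    lem₄ = solve-∀
  spread-digits : spreadOf b′ k ≡ spread D (D + h) (D + h) h
  spread-digits = spreadOf-value b′ (s≤s (m≤m+n D h)) ≤-refl ≤-refl (s≤s (m≤n+m h D)) k
    (+-cancelʳ-≡ (suc D + 0 * b′) _ _ (trans value (sym (arith b′ D h (D + h) refl refl))))
next b k D (suc e) E≤D D<b value with h , D+h≡b ← m≤n⇒∃[o]m+o≡n (<⇒≤ D<b)
                                     | f , e+f≡b ← m≤n⇒∃[o]m+o≡n (≤-trans (s≤s E≤D) D<b)
  with u , v , fold-D , fold-E , folded ← spread-steep {b} {D} {h} {e} {f} D+h≡b (trans (+-comm (e + f) 2) e+f≡b) =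
  subst (Next b (D , suc e)) (sym spread-digits) (steep fold-D fold-E folded)
  where
  arith : ∀ b D h e f → D + h ≡ b → 2 + e + f ≡ b →
    h + (f + (e + D * b) * b) * b + (D + suc e * b) ≡ D * b ^ 3 + suc e * b ^ 2
  arith b D h e f D+h≡b e+f≡b = begin
    h + (f + (e + D * b) * b) * b + (D + suc e * b)        ≡⟨ lem₁ b D h e f ⟩
    (D + h) + (1 + e + f + e * b + D * (b * b)) * b        ≡⟨ cong (_+ (1 + e + f + e * b + D * (b * b)) * b) D+h≡b ⟩
    b + (1 + e + f + e * b + D * (b * b)) * b              ≡⟨ lem₂ b D e f ⟩
    (2 + e + f + e * b + D * (b * b)) * b                  ≡⟨ cong (λ n → (n + e * b + D * (b * b)) * b) e+f≡b ⟩
    (b + e * b + D * (b * b)) * b                          ≡⟨ lem₃ b D e ⟩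
    D * (b * (b * (b * 1))) + suc e * (b * (b * 1)) ∎
    where
    open ≡-Reasoning
    lem₁ : ∀ b D h e f → h + (f + (e + D * b) * b) * b + (D + suc e * b) ≡
                         (D + h) + (1 + e + f + e * b + D * (b * b)) * b
    lem₁ = solve-∀
    lem₂ : ∀ b D e f → b + (1 + e + f + e * b + D * (b * b)) * b ≡ (2 + e + f + e * b + D * (b * b)) * b
    lem₂ = solve-∀
    lem₃ : ∀ b D e → (b + e * b + D * (b * b)) * b ≡ D * (b * (b * (b * 1))) + suc e * (b * (b * 1))
    lem₃ = solve-∀
  e≤b : suc (suc e) ≤ b
  e≤b = ≤-trans (s≤s E≤D) D<b
  h<b : h < b
  h<b = subst (h <_) D+h≡b (m<n+m h (≤-trans z<s E≤D))
  spread-digits : spreadOf b k ≡ spread D e f h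
  spread-digits = spreadOf-value b D<b (<⇒≤ e≤b) (subst (f <_) e+f≡b (s≤s (≤-trans (m≤n+m f e) (n≤1+n _)))) h<b k
    (+-cancelʳ-≡ (D + suc e * b) _ _ (trans value (sym (arith b D h e f D+h≡b e+f≡b))))

spreadOf-next : ∀ b x → Next b (spreadOf b x) (spreadOf b (K b x))
spreadOf-next b x with E≤D , D<b , value ← K-value b x refl = next b (K b x) _ _ E≤D D<b value

-- Folding modulo 5

double : Residue → Residue
double 0̄  = 0̄
double ±1 = ±2
double ±2 = ±1

opposite-double : ∀ α β → opposite (double α) (double β) ≡ opposite α β
opposite-double 0̄  β  = refl
opposite-double ±1 0̄  = refl
opposite-double ±1 ±1 = refl
opposite-double ±1 ±2 = refl
opposite-double ±2 0̄  = refl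
opposite-double ±2 ±1 = refl
opposite-double ±2 ±2 = refl

opposite-sym : ∀ α β → opposite α β ≡ opposite β α
opposite-sym 0̄  0̄  = refl
opposite-sym 0̄  ±1 = refl
opposite-sym 0̄  ±2 = refl
opposite-sym ±1 0̄  = refl
opposite-sym ±1 ±1 = refl
opposite-sym ±1 ±2 = refl
opposite-sym ±2 0̄  = refl
opposite-sym ±2 ±1 = refl
opposite-sym ±2 ±2 = refl

opposite-irrefl : ∀ α → opposite α α ≢ true
opposite-irrefl 0̄  ()
opposite-irrefl ±1 ()
opposite-irrefl ±2 ()

residue-2* : ∀ x → residue (2 * x) ≡ double (residue x)
residue-2* 0 = refl
residue-2* 1 = refl
residue-2* 2 = refl
residue-2* 3 = refl
residue-2* 4 = refl
residue-2* (suc (suc (suc (suc (suc x))))) = trans (cong residue (lem x)) (residue-2* x)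
  where
  lem : ∀ x → 2 * (5 + x) ≡ 10 + 2 * x
  lem = solve-∀

residue-neg : ∀ x y q → x + y ≡ q * 5 → residue y ≡ residue x
residue-neg 0 y q refl = trans (cong residue (sym (+-identityʳ (q * 5)))) (residue-periodic q 0)
residue-neg 1 y (suc q) refl = trans (cong residue (+-comm 4 (q * 5))) (residue-periodic q 4)
residue-neg 2 y (suc q) refl = trans (cong residue (+-comm 3 (q * 5))) (residue-periodic q 3)
residue-neg 3 y (suc q) refl = trans (cong residue (+-comm 2 (q * 5))) (residue-periodic q 2)
residue-neg 4 y (suc q) refl = trans (cong residue (+-comm 1 (q * 5))) (residue-periodic q 1)
residue-neg (suc (suc (suc (suc (suc x))))) y (suc q) eq = residue-neg x y q (+-cancelˡ-≡ 5 _ _ eq)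

residue-fold : ∀ q i i′ → Fold (q * 5) i i′ → residue i′ ≡ double (residue i)
residue-fold q i i′ (below eq) = trans (residue-neg (2 * i) i′ q eq) (residue-2* i)
residue-fold q i i′ (above eq) = trans (sym (residue-periodic q i′)) (trans (cong residue (sym eq)) (residue-2* i))

opposite-fold : ∀ q {i i′ j j′} → Fold (q * 5) i i′ → Fold (q * 5) j j′ →
                opposite (residue i′) (residue j′) ≡ opposite (residue i) (residue j)
opposite-fold q {i} {i′} {j} {j′} fold-i fold-j =
  trans (cong₂ opposite (residue-fold q i i′ fold-i) (residue-fold q j j′ fold-j))
        (opposite-double (residue i) (residue j))

-- Good pairs and multiples of the scale

fold-*-cancel : ∀ m .{{_ : NonZero m}} {M i i′} → Fold (M * m) (i * m) (i′ * m) → Fold M i i′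
fold-*-cancel m {M} {i} {i′} (below eq) = below (*-cancelʳ-≡ _ _ m (trans (lem i i′ m) eq))
  where
  lem : ∀ i i′ m → (2 * i + i′) * m ≡ 2 * (i * m) + i′ * m
  lem = solve-∀
fold-*-cancel m {M} {i} {i′} (above eq) = above (*-cancelʳ-≡ _ _ m
  (trans (*-assoc 2 i m) (trans eq (sym (*-distribʳ-+ m M i′)))))

fold-∣ : ∀ {m b x u} → m ∣ b → m ∣ 2 * x → Fold b x u → m ∣ u
fold-∣ {m} m∣b m∣2x (below eq) = ∣m+n∣m⇒∣n (subst (m ∣_) (sym eq) m∣b) m∣2x
fold-∣ {m} m∣b m∣2x (above eq) = ∣m+n∣m⇒∣n (subst (m ∣_) eq m∣2x) m∣b

fold-∣⁻¹ : ∀ {m b x u} → m ∣ b → m ∣ u → Fold b x u → m ∣ 2 * x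
fold-∣⁻¹ {m} {x = x} {u} m∣b m∣u (below eq) = ∣m+n∣m⇒∣n (subst (m ∣_) (trans (sym eq) (+-comm (2 * x) u)) m∣b) m∣u
fold-∣⁻¹ {m} m∣b m∣u (above eq) = subst (m ∣_) (sym eq) (∣m∣n⇒∣m+n m∣b m∣u)

fold-multiple : ∀ m .{{_ : NonZero m}} {M i u} → Fold (M * m) (i * m) u → ∃[ i′ ] u ≡ i′ * m × Fold M i i′
fold-multiple m {M} {i} fold
  with divides i′ refl ← fold-∣ (n∣m*n M) (∣n⇒∣m*n 2 (n∣m*n i)) fold = i′ , refl , fold-*-cancel m fold

odd⇒coprime-2 : ∀ {m} → ¬ 2 ∣ m → Coprime m 2
odd⇒coprime-2 2∤m {0} (_ , 0∣2) with () ← 0∣⇒≡0 0∣2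
odd⇒coprime-2 2∤m {1} _ = refl
odd⇒coprime-2 2∤m {2} (2∣m , _) = contradiction 2∣m 2∤m
odd⇒coprime-2 2∤m {suc (suc (suc d))} (_ , d∣2) with s≤s (s≤s ()) ← ∣⇒≤ d∣2

-- Folding back yields only that `m` divides 2x; oddness of `m` prevents the scale from being
-- halved.
fold-multiple⁻¹ : ∀ m .{{_ : NonZero m}} → ¬ 2 ∣ m → ∀ {M x i′} → Fold (M * m) x (i′ * m) →
                  ∃[ i ] x ≡ i * m × Fold M i i′
fold-multiple⁻¹ m 2∤m {M} {x} {i′} fold
  with divides i refl ← coprime-divisor {o = x} (odd⇒coprime-2 2∤m) (fold-∣⁻¹ (n∣m*n M) (n∣m*n i′) fold) =
  i , refl , fold-*-cancel m fold

-- With i = D/m and j = E/m, the residue condition says i² + j² ≡ 0 ≢ i² (mod 5).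
Good : ℕ → ℕ × ℕ → Set
Good m (D , E) = ∃₂ λ i j → D ≡ i * m × E ≡ j * m × opposite (residue i) (residue j) ≡ true

good-swap : ∀ m {D E} → Good m (D , E) → Good m (E , D)
good-swap m (i , j , D≡ , E≡ , opp) = j , i , E≡ , D≡ , trans (opposite-sym (residue j) (residue i)) opp

opposite-0ʳ : ∀ α → opposite α 0̄ ≢ true
opposite-0ʳ 0̄  ()
opposite-0ʳ ±1 ()
opposite-0ʳ ±2 ()

good-E≢0 : ∀ m .{{_ : NonZero m}} {D} → ¬ Good m (D , 0)
good-E≢0 m (i , zero , _ , _ , opp) = opposite-0ʳ (residue i) opp
good-E≢0 (suc m) (i , suc j , _ , () , _)

-- A tie would give both coefficients the same class, and no class is opposite to itself.
folded-good : ∀ m .{{_ : NonZero m}} {u v s} → Folded u v s → Good m (u , v) → Good m s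
folded-good m (outer _) good = good
folded-good m (inner _) good = good-swap m good
folded-good m (tied refl) (i , j , refl , v≡ , opp)
  with refl ← *-cancelʳ-≡ i j m v≡ = contradiction opp (opposite-irrefl (residue i))

good-step : ∀ m .{{_ : NonZero m}} q {s s′} → Next (q * 5 * m) s s′ → Good m s →
  ∃₂ λ i j → ∃₂ λ i′ j′ → Fold (q * 5) i i′ × Fold (q * 5) j j′ × opposite (residue i) (residue j) ≡ true ×
  s ≡ (i * m , j * m) × Folded (i′ * m) (j′ * m) s′
good-step m q zero       good = contradiction good (good-E≢0 m)
good-step m q (flat _ _) good = contradiction good (good-E≢0 m)
good-step m q (steep {v = v} fold-D fold-E folded) (i , j , refl , E≡ , opp)
  with i′ , refl , fold-i ← fold-multiple m {q * 5} {i} fold-D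
     | j′ , refl , fold-j ← fold-multiple m {q * 5} {j} {v} (subst (λ E → Fold (q * 5 * m) E v) E≡ fold-E) =
  i , j , i′ , j′ , fold-i , fold-j , opp , cong (i * m ,_) E≡ , folded

fold-even : ∀ q x {u} → Fold (2 * q * 5) x u → 2 ∣ u
fold-even q x = fold-∣ (∣m⇒∣m*n 5 (m∣m*n q)) (m∣m*n x)

-- Each step gains a factor of 2 as long as b is divisible by twice the scale.
good-double : ∀ m .{{_ : NonZero m}} q {s s′} → Next (2 * q * 5 * m) s s′ → Good m s → Good (2 * m) s′
good-double m q step good
  with i , j , i′ , j′ , fold-i , fold-j , opp , _ , folded ← good-step m (2 * q) step good
  with divides h refl ← fold-even q i fold-i | divides k refl ← fold-even q j fold-j =
  folded-good (2 * m) {{m*n≢0 2 m}} folded (h , k , *-assoc h 2 m , *-assoc k 2 m , (begin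
    opposite (residue h) (residue k)
      ≡⟨ opposite-double (residue h) (residue k) ⟨
    opposite (double (residue h)) (double (residue k))
      ≡⟨ cong₂ opposite (residue-*2 h) (residue-*2 k) ⟨
    opposite (residue (h * 2)) (residue (k * 2))
      ≡⟨ opposite-fold (2 * q) fold-i fold-j ⟩
    opposite (residue i) (residue j)
      ≡⟨ opp ⟩
    true ∎))
  where
  open ≡-Reasoning
  residue-*2 : ∀ h → residue (h * 2) ≡ double (residue h)
  residue-*2 h = trans (cong residue (*-comm h 2)) (residue-2* h)

fold-5-±1 : ∀ i i′ → i < 5 → residue i ≡ ±1 → Fold 5 i i′ → i′ ≡ 3
fold-5-±1 1 i′ _ _ (below refl) = refl
fold-5-±1 4 i′ _ _ (above refl) = refl
fold-5-±1 (suc (suc (suc (suc (suc _))))) i′ (s≤s (s≤s (s≤s (s≤s (s≤s ()))))) _ _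

fold-5-±2 : ∀ i i′ → i < 5 → residue i ≡ ±2 → Fold 5 i i′ → i′ ≡ 1
fold-5-±2 2 i′ _ _ (below refl) = refl
fold-5-±2 3 i′ _ _ (above refl) = refl
fold-5-±2 (suc (suc (suc (suc (suc _))))) i′ (s≤s (s≤s (s≤s (s≤s (s≤s ()))))) _ _

opposite-cases : ∀ α β → opposite α β ≡ true → α ≡ ±1 × β ≡ ±2 ⊎ α ≡ ±2 × β ≡ ±1
opposite-cases ±1 ±2 _ = inj₁ (refl , refl)
opposite-cases ±2 ±1 _ = inj₂ (refl , refl)

folded-31 : ∀ g .{{_ : NonZero g}} {s} → Folded (3 * g) (1 * g) s → s ≡ (3 * g , 1 * g)
folded-31 g (outer _)  = refl
folded-31 g (inner lt) = contradiction (*-cancelʳ-< g 3 1 lt) λ { (s≤s ()) }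
folded-31 g (tied eq)  with () ← *-cancelʳ-≡ 3 1 g eq

folded-13 : ∀ g .{{_ : NonZero g}} {s} → Folded (1 * g) (3 * g) s → s ≡ (3 * g , 1 * g)
folded-13 g (inner _)  = refl
folded-13 g (outer lt) = contradiction (*-cancelʳ-< g 3 1 lt) λ { (s≤s ()) }
folded-13 g (tied eq)  with () ← *-cancelʳ-≡ 1 3 g eq

-- At this scale the coefficients are below 5, where the class alone determines the fold: `±1` goes
-- to 3 and `±2` to 1. A good pair has one coefficient of each class, so a single step suffices from
-- all of them.
good-final : ∀ g .{{_ : NonZero g}} {D E s′} → E ≤ D → D < 5 * g → Next (5 * g) (D , E) s′ → Good g (D , E) →
             s′ ≡ (3 * g , 1 * g)
good-final g E≤D D<b step good
  with i , j , i′ , j′ , fold-i , fold-j , opp , refl , folded ← good-step g 1 step good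
  with opposite-cases (residue i) (residue j) opp
... | inj₁ (i±1 , j±2)
  with refl ← fold-5-±1 i i′ (*-cancelʳ-< g i 5 D<b) i±1 fold-i
     | refl ← fold-5-±2 j j′ (*-cancelʳ-< g j 5 (≤-<-trans E≤D D<b)) j±2 fold-j = folded-31 g folded
... | inj₂ (i±2 , j±1)
  with refl ← fold-5-±2 i i′ (*-cancelʳ-< g i 5 D<b) i±2 fold-i
     | refl ← fold-5-±1 j j′ (*-cancelʳ-< g j 5 (≤-<-trans E≤D D<b)) j±1 fold-j = folded-13 g folded

module _ (m : ℕ) .{{_ : NonTrivial m}} (2∤m : ¬ 2 ∣ m) where

  private instance
    m≢0 : NonZero m
    m≢0 = nonTrivial⇒nonZero m

  m∤1 : ¬ m ∣ 1
  m∤1 m∣1 = <⇒≱ (nonTrivial⇒n>1 m) (∣⇒≤ m∣1)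

  m∤2 : ¬ m ∣ 2
  m∤2 m∣2 = m∤1 (coprime-divisor {o = 1} (odd⇒coprime-2 2∤m) m∣2)

  ¬tied-multiple : ∀ u → m ∣ suc u → ¬ m ∣ ∣ u - 1 ∣
  ¬tied-multiple zero    m∣1+u m∣u-1 = m∤1 m∣1+u
  ¬tied-multiple (suc u) m∣2+u m∣u   =
    m∤2 (∣m+n∣m⇒∣n (subst (m ∣_) (+-comm 2 u) m∣2+u) (subst (m ∣_) (∣-∣-identityʳ u) m∣u))

  -- The irregular transitions have no good target: after `flat` the number `m` would divide b and b
  -- - 1, and `tied` is excluded by `¬tied-multiple`. Otherwise the class condition is pulled back
  -- because folding doubles both classes at once.
  good-backward : ∀ q {s s′} → Next (q * 5 * m) s s′ → Good m s′ → Good m s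
  good-backward q zero good = contradiction good (good-E≢0 m)
  good-backward q (flat sum≡ _) (i , j , refl , refl , _) =
    contradiction (∣m+n∣m⇒∣n (subst (m ∣_) (trans (sym sum≡) (+-comm 1 _)) (n∣m*n (q * 5))) (∣m∣n⇒∣m+n (n∣m*n i) (n∣m*n j))) m∤1
  good-backward q (steep fold-D fold-E (outer _)) (i , j , refl , refl , opp)
    with i₀ , D≡ , fold-i ← fold-multiple⁻¹ m 2∤m {q * 5} {i′ = i} fold-D
       | j₀ , E≡ , fold-j ← fold-multiple⁻¹ m 2∤m {q * 5} {i′ = j} fold-E =
    i₀ , j₀ , D≡ , E≡ , trans (sym (opposite-fold q fold-i fold-j)) opp
  good-backward q (steep fold-D fold-E (inner _)) (i , j , refl , refl , opp)
    with i₀ , D≡ , fold-i ← fold-multiple⁻¹ m 2∤m {q * 5} {i′ = j} fold-D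
       | j₀ , E≡ , fold-j ← fold-multiple⁻¹ m 2∤m {q * 5} {i′ = i} fold-E =
    i₀ , j₀ , D≡ , E≡ , trans (sym (opposite-fold q fold-i fold-j)) (trans (opposite-sym (residue j) (residue i)) opp)
  good-backward q (steep {u = u} _ _ (tied refl)) (i , j , u+1≡ , u-1≡ , opp) =
    contradiction (divides j u-1≡) (¬tied-multiple u (divides i u+1≡))

-- Fixed pairs and the eventual behaviour

fold-fixed : ∀ {b x} → x < b → Fold b x x → 3 * x ≡ b
fold-fixed {x = x} x<b (below eq) = trans (lem x) eq
  where
  lem : ∀ x → 3 * x ≡ 2 * x + x
  lem = solve-∀
fold-fixed {b} {x} x<b (above eq) = contradiction (+-cancelʳ-≡ x _ _ (trans (cong (x +_) (sym (+-identityʳ x))) eq)) (<⇒≢ x<b)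

fold-swapped : ∀ {b D E} → E < D → Fold b D E → Fold b E D → D ≡ 3 * E × 5 * E ≡ b
fold-swapped {b} {D} {E} E<D (below p) (below q) = contradiction
  (+-cancelʳ-≡ (D + E) _ _ (trans (lem E D) (trans (trans q (sym p)) (sym (lem′ E D))))) (<⇒≢ E<D)
  where
  lem : ∀ E D → E + (D + E) ≡ 2 * E + D
  lem = solve-∀
  lem′ : ∀ E D → D + (D + E) ≡ 2 * D + E
  lem′ = solve-∀
fold-swapped {b} {D} {E} E<D (below p) (above q) = contradiction
  (+-cancelʳ-≡ E _ _ (trans (lem E) (trans q (trans (cong (_+ D) (sym p)) (lem′ E D))))) (<⇒≢ (≤-trans E<D (m≤m+n D (2 * D))))
  where
  lem : ∀ E → E + E ≡ 2 * E
  lem = solve-∀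
  lem′ : ∀ E D → 2 * D + E + D ≡ 3 * D + E
  lem′ = solve-∀
fold-swapped {b} {D} {E} E<D (above p) (above q) = contradiction E<D
  (<-asym (*-cancelˡ-< 2 D E (subst₂ _<_ (sym p) (sym q) (+-monoʳ-< b E<D))))
fold-swapped {b} {D} {E} E<D (above p) (below q) = D≡3E , (begin
  5 * E         ≡⟨ lem₂ E ⟩
  2 * E + 3 * E ≡⟨ cong (2 * E +_) D≡3E ⟨
  2 * E + D     ≡⟨ q ⟩
  b ∎)
  where
  open ≡-Reasoning
  lem : ∀ D E → 2 * E + D + E ≡ 3 * E + D
  lem = solve-∀
  lem₂ : ∀ E → 5 * E ≡ 2 * E + 3 * E
  lem₂ = solve-∀
  D≡3E : D ≡ 3 * E
  D≡3E = +-cancelʳ-≡ D _ _ (trans (cong (D +_) (sym (+-identityʳ D))) (trans p (trans (cong (_+ E) (sym q)) (lem D E))))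

-- This is where the bound on `b` comes from: tied fixed pairs do exist in small bases, namely (1 ,
-- 1) for b = 2 and (3 , 1) for b = 4.
fold-tied : ∀ {b} u → 4 < b → suc u < b → Fold b (suc u) u → Fold b ∣ u - 1 ∣ u → ⊥
fold-tied zero 4<b _ (below refl) _ with s≤s (s≤s ()) ← 4<b
fold-tied zero 4<b _ (above 2≡b+0) _ with refl ← trans 2≡b+0 (+-identityʳ _) with s≤s (s≤s ()) ← 4<b
fold-tied {b} (suc u) 4<b D<b fold-D fold-E = absurd fold-D (subst (λ E → Fold b E (suc u)) (∣-∣-identityʳ u) fold-E)
  where
  lem₁ : ∀ u → u + u ≡ 2 * u
  lem₁ = solve-∀
  lem₂ : ∀ u → 2 + 2 * u + 2 ≡ 2 * (2 + u)
  lem₂ = solve-∀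
  lem₃ : ∀ u → 2 * u + suc u + suc u ≡ 2 + 2 * u + 2 * u
  lem₃ = solve-∀
  absurd : Fold b (2 + u) (suc u) → Fold b u (suc u) → ⊥
  absurd _ (above q) = <-irrefl (+-cancelʳ-≡ u _ _ (trans (lem₁ u) (trans q (+-suc b u))))
    (<-trans (s≤s (n≤1+n u)) (<-trans D<b (n<1+n b)))
  absurd (below p) (below q) =
    <⇒≢ (s≤s (n≤1+n u)) (sym (*-cancelˡ-≡ (2 + u) u 2 (+-cancelʳ-≡ (suc u) (2 * (2 + u)) (2 * u) (trans p (sym q)))))
  absurd (above p) (below q)
    with refl ← *-cancelˡ-≡ 1 u 2 (+-cancelˡ-≡ (2 + 2 * u) 2 (2 * u) (trans (lem₂ u) (trans p (trans (cong (_+ suc u) (sym q)) (lem₃ u)))))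
       | refl ← q = <-irrefl refl 4<b

-- If each entry were its own fold, both would equal b / 3; hence a fixed pair with E > 0 and no tie
-- must have entries that fold into each other.
next-fixed : ∀ {b D E} → 4 < b → D < b → Next b (D , E) (D , E) →
             (D , E) ≡ (0 , 0) ⊎ D ≡ 3 * E × 5 * E ≡ b
next-fixed 4<b D<b zero = inj₁ refl
next-fixed 4<b D<b (flat sum≡ (inj₁ ()))
next-fixed {D = D} 4<b D<b (flat refl (inj₂ eq))
  with refl ← +-cancelˡ-≡ D D 1 (trans eq (trans (cong suc (+-identityʳ D)) (+-comm 1 D))) with s≤s (s≤s ()) ← 4<b
next-fixed {b} {D} {suc e} 4<b D<b (steep fold-D fold-E folded) = inj₂ (case folded refl fold-D fold-E)
  where
  case : ∀ {u v s} → Folded u v s → s ≡ (D , suc e) → Fold b D u → Fold b (suc e) v → D ≡ 3 * suc e × 5 * suc e ≡ b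
  case (outer E<D) refl fold-D fold-E =
    contradiction (*-cancelˡ-≡ _ _ 3 (trans (fold-fixed (<-trans E<D D<b) fold-E) (sym (fold-fixed D<b fold-D)))) (<⇒≢ E<D)
  case (inner E<D) refl fold-D fold-E = fold-swapped E<D fold-D fold-E
  case {u} (tied refl) eq fold-D fold-E with refl ← cong proj₁ eq =
    ⊥-elim (fold-tied u 4<b D<b fold-D (subst (λ E → Fold b E u) (sym (cong proj₂ eq)) fold-E))

residue-2^ : ∀ n → residue (2 ^ n) ≢ 0̄
residue-2^ zero    ()
residue-2^ (suc n) eq = residue-2^ n (double-0̄ (residue (2 ^ n)) (trans (sym (residue-2* (2 ^ n))) eq))
  where
  double-0̄ : ∀ α → double α ≡ 0̄ → α ≡ 0̄
  double-0̄ 0̄ _ = refl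

opposite-double-self : ∀ α → α ≢ 0̄ → opposite (double α) α ≡ true
opposite-double-self 0̄  α≢0 = contradiction refl α≢0
opposite-double-self ±1 α≢0 = refl
opposite-double-self ±2 α≢0 = refl

module Dynamics (b m n : ℕ) .{{_ : NonTrivial m}} (2∤m : ¬ 2 ∣ m) (b≡ : b ≡ 2 ^ n * 5 * m) where

  private instance
    m≢0 : NonZero m
    m≢0 = nonTrivial⇒nonZero m

  open Iterates (K b)

  σ : FourDigit b → ℕ × ℕ
  σ = spreadOf b

  4<b : 4 < b
  4<b = subst (4 <_) (sym b≡) (≤-trans (*-monoˡ-≤ 5 (m^n>0 2 n)) (m≤m*n (2 ^ n * 5) m))

  -- The coefficient `3 * 2 ^ n` is the fold of `2 ^ n` with respect to `2 ^ n * 5`. Its class is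
  -- thus the double of a nonzero class, which is the opposite one.
  fixed-good : ∀ {D E} → D ≡ 3 * E × 5 * E ≡ b → Good m (D , E)
  fixed-good {E = E} (refl , 5E≡b) = 3 * 2 ^ n , 2 ^ n , 3E≡ , E≡ ,
    trans (cong (λ α → opposite α (residue (2 ^ n))) (residue-fold (2 ^ n) (2 ^ n) (3 * 2 ^ n) (below (lem (2 ^ n)))))
          (opposite-double-self (residue (2 ^ n)) (residue-2^ n))
    where
    lem : ∀ q → 2 * q + 3 * q ≡ q * 5
    lem = solve-∀
    E≡ : E ≡ 2 ^ n * m
    E≡ = *-cancelˡ-≡ _ _ 5 (trans 5E≡b (trans b≡ (trans (cong (_* m) (*-comm (2 ^ n) 5)) (*-assoc 5 (2 ^ n) m))))
    3E≡ : 3 * E ≡ 3 * 2 ^ n * m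
    3E≡ = trans (cong (3 *_) E≡) (sym (*-assoc 3 (2 ^ n) m))

  good-iterate⁻¹ : ∀ t x → Good m (σ (iterate (K b) x t)) → Good m (σ x)
  good-iterate⁻¹ zero    x good = good
  good-iterate⁻¹ (suc t) x good =
    good-backward m 2∤m (2 ^ n) (subst (λ b′ → Next b′ (σ x) (σ (K b x))) b≡ (spreadOf-next b x))
      (good-iterate⁻¹ t (K b x) good)

  sound : ∀ x → EventuallyNonzeroConstant b x → Good m (σ x)
  sound x (c , c≢0 , T , lim) = good-iterate⁻¹ T x (subst (λ y → Good m (σ y)) (sym (lim T ≤-refl)) good-c)
    where
    Kc≡c : K b c ≡ c
    Kc≡c = limit-fixed x c T lim
    good-c : Good m (σ c)
    good-c = [ (λ σc≡0 → contradiction (trans (sym (cong toℕ Kc≡c)) (K-zero b c σc≡0)) c≢0) , fixed-good ]′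
      (next-fixed 4<b (proj₁ (proj₂ (K-value b c refl))) (subst (λ y → Next b (σ c) (σ y)) Kc≡c (spreadOf-next b c)))

  -- The scale varies in the induction: every step moves one factor 2 of `b` from the cofactor
  -- `2 ^ k` into `m′`.
  good-iterate : ∀ k m′ .{{_ : NonZero m′}} x → b ≡ 2 ^ k * 5 * m′ → Good m′ (σ x) →
                 Good (2 ^ k * m′) (σ (iterate (K b) x k))
  good-iterate zero    m′ x b≡ good = subst (λ m → Good m (σ x)) (sym (*-identityˡ m′)) good
  good-iterate (suc k) m′ x b≡ good = subst (λ g → Good g (σ (iterate (K b) (K b x) k))) (lem₁ (2 ^ k) m′)
    (good-iterate k (2 * m′) {{m*n≢0 2 m′}} (K b x) (trans b≡ (lem₂ (2 ^ k) m′))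
      (good-double m′ (2 ^ k) (subst (λ b′ → Next b′ (σ x) (σ (K b x))) b≡ (spreadOf-next b x)) good))
    where
    lem₁ : ∀ q m → q * (2 * m) ≡ 2 * q * m
    lem₁ = solve-∀
    lem₂ : ∀ q m → 2 * q * 5 * m ≡ q * 5 * (2 * m)
    lem₂ = solve-∀

  complete : ∀ x → Good m (σ x) → EventuallyNonzeroConstant b x
  -- After `n` steps the scale is `g`, and one more step reaches the pair (3g , g). The second extra
  -- step is for the number itself: `y` and `c` share this pair, so they have the same image, and
  -- that image is `c`.
  complete x good = c , c≢0 , n + 2 , λ t T≤t →
    trans (cong (iterate (K b) x) (sym (m+[n∸m]≡n T≤t)))
    (trans (iterate-+ x (n + 2) (t ∸ (n + 2)))
    (trans (cong (λ y → iterate (K b) y (t ∸ (n + 2))) (iterate-+ x n 2))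
           (iterate-fix Kc≡c (t ∸ (n + 2)))))
    where
    g = 2 ^ n * m
    instance
      g≢0 : NonZero g
      g≢0 = m*n≢0 (2 ^ n) m {{m^n≢0 2 n}}
    b≡5g : b ≡ 5 * g
    b≡5g = trans b≡ (trans (cong (_* m) (*-comm (2 ^ n) 5)) (*-assoc 5 (2 ^ n) m))
    z y c : FourDigit b
    z = iterate (K b) x n
    y = K b z
    c = K b y
    final : ∀ w → Good g (σ w) → σ (K b w) ≡ (3 * g , 1 * g)
    final w good =
      good-final g (proj₁ (K-value b w refl))
        (subst (proj₁ (σ w) <_) b≡5g (proj₁ (proj₂ (K-value b w refl))))
        (subst (λ b′ → Next b′ (σ w) (σ (K b w))) b≡5g (spreadOf-next b w)) good
    σy≡ : σ y ≡ (3 * g , 1 * g)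
    σy≡ = final z (good-iterate n m x b≡ good)
    σc≡ : σ c ≡ (3 * g , 1 * g)
    σc≡ = final y (3 , 1 , cong proj₁ σy≡ , cong proj₂ σy≡ , refl)
    Kc≡c : K b c ≡ c
    Kc≡c = K-cong b c y (trans σc≡ (sym σy≡))
    c≢0 : toℕ c ≢ 0
    c≢0 c≡0 = m*n≢0⇒m≢0′ (trans (sym (cong proj₂ σc≡)) (cong proj₂ (spreadOf-zero b c c≡0)))
      where
      m*n≢0⇒m≢0′ : 1 * g ≢ 0
      m*n≢0⇒m≢0′ eq = ≢-nonZero⁻¹ g (trans (sym (*-identityˡ g)) eq)

-- Cardinality of S

good-*⁻¹ : ∀ m .{{_ : NonZero m}} {i j} → Good m (i * m , j * m) → opposite (residue i) (residue j) ≡ true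
good-*⁻¹ m {i} {j} (i′ , j′ , D≡ , E≡ , opp)
  with refl ← *-cancelʳ-≡ i i′ m D≡ | refl ← *-cancelʳ-≡ j j′ m E≡ = opp

good? : ∀ m .{{_ : NonZero m}} s → Dec (Good m s)
good? m (D , E) with m ∣? D | m ∣? E
... | no m∤D | _      = no λ (i , _ , D≡ , _) → m∤D (divides i D≡)
... | yes _  | no m∤E = no λ (_ , j , _ , E≡ , _) → m∤E (divides j E≡)
... | yes (divides i refl) | yes (divides j refl) with opposite (residue i) (residue j) in opp
...   | true  = yes (i , j , refl , refl , opp)
...   | false = no λ good → contradiction (trans (sym (good-*⁻¹ m {i} {j} good)) opp) λ ()

module Indicator (m : ℕ) .{{_ : NonZero m}} where

  -- Goodness is symmetric, so this is also 1 at some pairs with D < E; the truncated weight `D ∸ E`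
  -- discards them in the sums.
  indicator : ℕ → ℕ → ℕ
  indicator D E = ⟦ does (good? m (D , E)) ⟧

  indicator-no : ∀ {D E} → ¬ Good m (D , E) → indicator D E ≡ 0
  indicator-no {D} {E} ¬good = cong ⟦_⟧ (dec-false (good? m (D , E)) ¬good)

  indicator-zero : ∀ n → indicator n 0 ≡ 0
  indicator-zero n = indicator-no (good-E≢0 m)

  indicator-diag : ∀ n → indicator n n ≡ 0
  indicator-diag n = indicator-no λ { (i , j , refl , E≡ , opp) → opposite-irrefl (residue i)
    (subst (λ k → opposite (residue i) (residue k) ≡ true) (sym (*-cancelʳ-≡ i j m E≡)) opp) }

  indicator-∤ˡ : ∀ D E → ¬ m ∣ D → indicator D E ≡ 0
  indicator-∤ˡ D E m∤D = indicator-no λ (i , _ , D≡ , _) → m∤D (divides i D≡)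

  indicator-∤ʳ : ∀ D E → ¬ m ∣ E → indicator D E ≡ 0
  indicator-∤ʳ D E m∤E = indicator-no λ (_ , j , _ , E≡ , _) → m∤E (divides j E≡)

  indicator-* : ∀ i j → indicator (i * m) (j * m) ≡ χ i j
  indicator-* i j with opposite (residue i) (residue j) in opp
  ... | true  = cong ⟦_⟧ (dec-true (good? m (i * m , j * m)) (i , j , refl , refl , opp))
  ... | false = indicator-no λ good → contradiction (trans (sym (good-*⁻¹ m {i} {j} good)) opp) λ ()

sum-number : ∀ b (f : FourDigit b → ℕ) →
  sum f ≡ sum {b} λ w → sum {b} λ x → sum {b} λ y → sum {b} λ z → f (number b w x y z)
sum-number b f =
  trans (sum-combine b f) (sum-cong-≗ {b} λ w →
  trans (sum-combine b _) (sum-cong-≗ {b} λ x →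
  trans (sum-combine b _) (sum-cong-≗ {b} λ y →
  -- The innermost sum runs over `Fin (b ^ 0)`, a single index, which leaves a trailing zero.
  trans (sum-combine b _) (sum-cong-≗ {b} λ z → +-identityʳ _))))

sum⁴ : ∀ b (F : ℕ → ℕ → ℕ → ℕ → ℕ) →
  (sum {b} λ w → sum {b} λ x → sum {b} λ y → sum {b} λ z → F (toℕ w) (toℕ x) (toℕ y) (toℕ z)) ≡ ∑⁴ b F
sum⁴ b F = sym
  (trans (∑<≡sum b _) (sum-cong-≗ {b} λ w →
  trans (∑<≡sum b _) (sum-cong-≗ {b} λ x →
  trans (∑<≡sum b _) (sum-cong-≗ {b} λ y → ∑<≡sum b _))))

card-S : ∀ b m n .{{_ : NonTrivial m}} → ¬ 2 ∣ m → b ≡ 2 ^ n * 5 * m →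
         ∣ S b ∣ ≡ 8 * m * m * (5 * 2 ^ n * 2 ^ n + 25 * 2 ^ n * 2 ^ n * 2 ^ n * 2 ^ n)
card-S b m n 2∤m b≡ = begin
  ∣ S b ∣
    ≡⟨ card-tabulate (λ x → does (eventuallyNonzeroConstant? b x)) ⟩
  sum (λ x → ⟦ does (eventuallyNonzeroConstant? b x) ⟧)
    ≡⟨ sum-cong-≗ {b ^ 4} (λ x → cong ⟦_⟧ (does-⇔ (mk⇔ (sound x) (complete x)) (eventuallyNonzeroConstant? b x) (good? m (spreadOf b x)))) ⟩
  sum {b ^ 4} (λ x → G (spreadOf b x))
    ≡⟨ sum-number b (λ x → G (spreadOf b x)) ⟩
  (sum {b} λ w → sum {b} λ x → sum {b} λ y → sum {b} λ z → G (spreadOf b (number b w x y z)))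
    ≡⟨ (sum-cong-≗ {b} λ w → sum-cong-≗ {b} λ x → sum-cong-≗ {b} λ y → sum-cong-≗ {b} λ z → cong G (spreadOf-number b w x y z)) ⟩
  (sum {b} λ w → sum {b} λ x → sum {b} λ y → sum {b} λ z → F (toℕ w) (toℕ x) (toℕ y) (toℕ z))
    ≡⟨ sum⁴ b F ⟩
  ∑⁴ b F
    ≡⟨ ∑⁴-sorted b F
         (λ w x y z → cong G (spread-swap₁₂ w x y z))
         (λ w x y z → cong G (spread-swap₂₃ w x y z))
         (λ w x y z → cong G (spread-swap₃₄ w x y z))
         (λ z≤y y≤x x≤w → cong G (spread-descending z≤y y≤x x≤w)) ⟩
  24 * ∑[ D < b ] ((b ∸ D) * ∑[ E < b ] ((D ∸ E) * indicator D E))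
    ≡⟨ cong (λ b → 24 * ∑[ D < b ] ((b ∸ D) * ∑[ E < b ] ((D ∸ E) * indicator D E))) b≡ ⟩
  24 * ∑[ D < 2 ^ n * 5 * m ] ((2 ^ n * 5 * m ∸ D) * ∑[ E < 2 ^ n * 5 * m ] ((D ∸ E) * indicator D E))
    ≡⟨ cong (24 *_) (∑-lattice m (2 ^ n * 5) indicator indicator-∤ˡ indicator-∤ʳ indicator-*) ⟩
  24 * (m * m * volume (2 ^ n * 5))
    ≡⟨ lem m (volume (2 ^ n * 5)) ⟩
  8 * m * m * (3 * volume (2 ^ n * 5))
    ≡⟨ cong (8 * m * m *_) (volume-closed (2 ^ n)) ⟩
  8 * m * m * (5 * 2 ^ n * 2 ^ n + 25 * 2 ^ n * 2 ^ n * 2 ^ n * 2 ^ n) ∎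
  where
  open ≡-Reasoning
  instance
    m≢0 : NonZero m
    m≢0 = nonTrivial⇒nonZero m
  open Dynamics b m n 2∤m b≡
  open Indicator m
  open Gaps indicator indicator-zero indicator-diag
  G : ℕ × ℕ → ℕ
  G (D , E) = indicator D E
  F : ℕ → ℕ → ℕ → ℕ → ℕ
  F w x y z = G (spread w x y z)
  lem : ∀ m v → 24 * (m * m * v) ≡ 8 * m * m * (3 * v)
  lem = solve-∀

-- From the cardinality to the rational identities

open import Data.Integer.Base using (+_)

/-cross : ∀ p q r s .{{_ : NonZero q}} .{{_ : NonZero s}} → p * s ≡ r * q → + p / q ≡ + r / s
/-cross p q@(suc _) r s@(suc _) eq = ℚ.fromℚᵘ-cong {mkℚᵘ (+ p) _} {mkℚᵘ (+ r) _}
  (*≡* (trans (sym (ℤ.pos-* p s)) (trans (cong +_ eq) (ℤ.pos-* r q))))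

/-+ : ∀ p q r s t u .{{_ : NonZero q}} .{{_ : NonZero s}} .{{_ : NonZero u}} →
      t * (q * s) ≡ (p * s + r * q) * u → + t / u ≡ + p / q ℚ.+ + r / s
/-+ p q@(suc _) r s@(suc _) t u@(suc _) eq = ℚ.toℚᵘ-injective (begin
  toℚᵘ (+ t / u)                           ≈⟨ ℚ.toℚᵘ-fromℚᵘ (mkℚᵘ (+ t) _) ⟩
  mkℚᵘ (+ t) _                             ≈⟨ *≡* cross ⟩
  mkℚᵘ (+ p) _ ℚᵘ.+ mkℚᵘ (+ r) _           ≈⟨ ℚᵘ.+-cong (ℚ.toℚᵘ-fromℚᵘ (mkℚᵘ (+ p) _)) (ℚ.toℚᵘ-fromℚᵘ (mkℚᵘ (+ r) _)) ⟨
  toℚᵘ (+ p / q) ℚᵘ.+ toℚᵘ (+ r / s)       ≈⟨ ℚ.toℚᵘ-homo-+ (+ p / q) (+ r / s) ⟨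
  toℚᵘ (+ p / q ℚ.+ + r / s)               ∎)
  where
  open ℚᵘ.≃-Reasoning
  cross : + t ℤ.* + (q * s) ≡ (+ p ℤ.* + s ℤ.+ + r ℤ.* + q) ℤ.* + u
  cross = trans (sym (ℤ.pos-* t (q * s))) (trans (cong +_ eq) (trans (ℤ.pos-* (p * s + r * q) u)
    (cong (ℤ._* + u) (trans (ℤ.pos-+ (p * s) (r * q)) (cong₂ ℤ._+_ (ℤ.pos-* p s) (ℤ.pos-* r q))))))

4^n≡2^n*2^n : ∀ n → 4 ^ n ≡ 2 ^ n * 2 ^ n
4^n≡2^n*2^n zero    = refl
4^n≡2^n*2^n (suc n) = trans (cong (4 *_) (4^n≡2^n*2^n n)) (lem (2 ^ n))
  where
  lem : ∀ q → 4 * (q * q) ≡ 2 * q * (2 * q)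
  lem = solve-∀

theorem1p2 :
    ∀ (b m n : ℕ) → .{{_ : NonTrivial b}} → .{{_ : NonTrivial m}} →
    ¬ (2 ∣ m) →
    b ≡ 5 * m * 2 ^ n →
    let instance
          _ = a*b²≢0 b 5
          _ = a*b²≢0 m 25
    in C b ≡ + (8 + 40 * 4 ^ n) / (5 * b ^ 2)
       × + (8 + 40 * 4 ^ n) / (5 * b ^ 2) ≡ + 8 / (5 * b ^ 2) ℚ.+ + 8 / (25 * m ^ 2)
theorem1p2 b m n 2∤m refl =
  /-cross ∣ S b ∣ (b ^ 4) (8 + 40 * 4 ^ n) (5 * b ^ 2) {{b^k≢0 b 4}} {{a*b²≢0 b 5}} count≡ ,
  /-+ 8 (5 * b ^ 2) 8 (25 * m ^ 2) (8 + 40 * 4 ^ n) (5 * b ^ 2) {{a*b²≢0 b 5}} {{a*b²≢0 m 25}} {{a*b²≢0 b 5}} sum≡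
  where
  q = 2 ^ n
  lem : ∀ m q → 5 * m * q ≡ q * 5 * m
  lem = solve-∀
  lem₁ : ∀ m q → 8 * m * m * (5 * q * q + 25 * q * q * q * q) * (5 * (5 * m * q * (5 * m * q * 1))) ≡
    (8 + 40 * (q * q)) * (5 * m * q * (5 * m * q * (5 * m * q * (5 * m * q * 1))))
  lem₁ = solve-∀
  count≡ : ∣ S b ∣ * (5 * b ^ 2) ≡ (8 + 40 * 4 ^ n) * b ^ 4
  count≡ = trans (cong (_* (5 * b ^ 2)) (card-S b m n 2∤m (lem m q)))
    (trans (lem₁ m q) (cong (λ r → (8 + 40 * r) * b ^ 4) (sym (4^n≡2^n*2^n n))))
  -- Since b² = 25 m² q², the part 40 q² / (5 b²) of the fraction is 8 / (25 m²); here this is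
  -- stated after clearing denominators.
  lem₂ : ∀ m q → (8 + 40 * (q * q)) * (25 * (m * (m * 1))) ≡
    8 * (25 * (m * (m * 1))) + 8 * (5 * (5 * m * q * (5 * m * q * 1)))
  lem₂ = solve-∀
  lem₃ : ∀ x y z → x * (y * z) ≡ x * z * y
  lem₃ = solve-∀
  sum≡ : (8 + 40 * 4 ^ n) * (5 * b ^ 2 * (25 * m ^ 2)) ≡ (8 * (25 * m ^ 2) + 8 * (5 * b ^ 2)) * (5 * b ^ 2)
  sum≡ = trans (lem₃ (8 + 40 * 4 ^ n) (5 * b ^ 2) (25 * m ^ 2)) (cong (_* (5 * b ^ 2))
    (trans (cong (λ r → (8 + 40 * r) * (25 * m ^ 2)) (4^n≡2^n*2^n n)) (lem₂ m q)))
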